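{- Let $G$ be a graph. Then $G\in F(\chi,2)$ if and only if $G$ contains a dominating vertex $v$ and one of the following holds: (1) $G-v \cong \overline{K_4}$ (the edgeless graph on $4$ vertices); (2) $G-v$ has $5$ vertices, contains $K_2\cup K_2\cup K_1$ as a (not necessarily induced) spanning subgraph, and is a (not necessarily induced) subgraph of $K_{2,3}$; (3) $G-v$ has $6$ vertices, is a (not necessarily induced) subgraph of $K_6-3e$, and one of the following holds: (a) $G-v\cong S_3$; (b) $G-v$ contains $K_3\cup K_3$ as a spanning subgraph; (c) $G-v\cong C_5^{(3)}$; (d) $G-v\cong C_5^{(4)}$. In particular, $F(\omega,2)\setminus \{W_5\} = F(\chi,2)\setminus \{C_5^{(3)}, C_5^{(4)}\}$ (where in the last equation $C_5^{(3)}$, $C_5^{(4)}$ denote these graphs with an added dominating vertex).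
   Context: All graphs are finite and simple; a dominating vertex is one adjacent to all other vertices. $G\cup H$ is the disjoint union; $K_n$ the complete graph, $K_{2,3}$ the complete bipartite graph with parts of sizes 2 and 3. $K_6-3e$ is $K_6$ with a perfect matching (three pairwise disjoint edges) removed. $S_3$ (the 3-sun) is a triangle $abc$ together with three vertices $x,y,z$ where $x$ is adjacent exactly to $a,b$, $y$ exactly to $b,c$, $z$ exactly to $c,a$. $C_5^{(3)}$ (resp. $C_5^{(4)}$) is a $5$-cycle together with one additional vertex adjacent to exactly three (resp. four) consecutive vertices of the cycle. $W_5$ is $C_5$ with an added dominating vertex. $\Delta,\omega,\chi$ denote maximum degree, clique number, chromatic number. For $k\in\mathbb{N}_0$: $\varOmega_k$ is the class of graphs $G$ such that every induced subgraph $H$ of $G$ (including $G$) satisfies $\Delta(H)\le\omega(H)+k-1$; $\varUpsilon_k$ is the class of graphs $G$ such that every induced subgraph $H$ of $G$ (including $G$) satisfies $\Delta(H)\le\chi(H)+k-1$. $F(\omega,k)$ (resp. $F(\chi,k)$) is the set of minimal forbidden induced subgraphs of $\varOmega_k$ (resp. $\varUpsilon_k$): graphs not in the class all of whose proper induced subgraphs are in the class (up to isomorphism). -}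

module Defs where

open import Data.Nat using (ℕ; zero; suc; _+_; _⊔_; _≤_; _<_; _≡ᵇ_)
open import Data.Bool using (Bool; true; false; if_then_else_; _∧_; _∨_)
import Data.Bool as B
open import Data.Fin using (Fin; zero; suc; toℕ)
open import Data.Fin.Properties using (all?)
open import Data.List using (List; []; _∷_)
open import Data.Bool.ListAction using (any)
open import Data.Product using (Σ; _×_; _,_; proj₁; proj₂)
open import Data.Empty using (⊥)
open import Relation.Nullary using (¬_; Dec)
open import Data.Sum using (_⊎_)
open import Relation.Nullary.Decidable using (toWitness; True)
open import Relation.Binary.PropositionalEquality using (_≡_; _≢_; refl)
open import Function using (_∘_)
open import Function.Definitions using (Injective)
open import Function.Bundles using (_↔_; Inverse)

record Graph (n : ℕ) : Set where
  field
    adj    : Fin n → Fin n → Bool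
    sym    : ∀ i j → adj i j ≡ adj j i
    irrefl : ∀ i → adj i i ≡ false
open Graph public

InducedSub : ∀ {m n} → Graph m → Graph n → Set
InducedSub {m} {n} H G =
  Σ (Fin m → Fin n) λ f → Injective _≡_ _≡_ f × (∀ i j → adj H i j ≡ adj G (f i) (f j))

SubgraphOf : ∀ {m n} → Graph m → Graph n → Set
SubgraphOf {m} {n} H G =
  Σ (Fin m → Fin n) λ f → Injective _≡_ _≡_ f × (∀ i j → adj H i j ≡ true → adj G (f i) (f j) ≡ true)

_≅_ : ∀ {m n} → Graph m → Graph n → Set
_≅_ {m} {n} G H = Σ (Fin m ↔ Fin n) λ e → ∀ i j → adj G i j ≡ adj H (Inverse.to e i) (Inverse.to e j)

count : ∀ {n} → (Fin n → Bool) → ℕ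
count {zero}  f = 0
count {suc n} f = (if f zero then 1 else 0) + count (f ∘ suc)

maxOver : ∀ {n} → (Fin n → ℕ) → ℕ
maxOver {zero}  f = 0
maxOver {suc n} f = f zero ⊔ maxOver (f ∘ suc)

degree : ∀ {n} → Graph n → Fin n → ℕ
degree G v = count (adj G v)

-- Δ(G) (0 for the empty graph)
Δ : ∀ {n} → Graph n → ℕ
Δ G = maxOver (degree G)

HasClique : ∀ {n} → Graph n → ℕ → Set
HasClique {n} G s =
  Σ (Fin s → Fin n) λ f → Injective _≡_ _≡_ f × (∀ i j → i ≢ j → adj G (f i) (f j) ≡ true)

IsCliqueNumber : ∀ {n} → Graph n → ℕ → Set
IsCliqueNumber G w = HasClique G w × (∀ s → HasClique G s → s ≤ w)

Colorable : ∀ {n} → Graph n → ℕ → Set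
Colorable {n} G c = Σ (Fin n → Fin c) λ col → ∀ i j → adj G i j ≡ true → col i ≢ col j

IsChromaticNumber : ∀ {n} → Graph n → ℕ → Set
IsChromaticNumber G c = Colorable G c × (∀ c' → Colorable G c' → c ≤ c')

-- The classes Ω_k and Υ_k.  "Δ(H) ≤ ω(H) + k - 1" is written Δ(H) + 1 ≤ ω(H) + k
-- (equivalent over the integers, avoiding truncated subtraction).

InΩ : ℕ → ∀ {n} → Graph n → Set
InΩ k G = ∀ m (H : Graph m) → InducedSub H G → ∀ w → IsCliqueNumber H w → Δ H + 1 ≤ w + k

InΥ : ℕ → ∀ {n} → Graph n → Set
InΥ k G = ∀ m (H : Graph m) → InducedSub H G → ∀ c → IsChromaticNumber H c → Δ H + 1 ≤ c + k

MinForbidden : (∀ {n} → Graph n → Set) → ∀ {n} → Graph n → Set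
MinForbidden P {n} G = ¬ P G × (∀ m (H : Graph m) → m < n → InducedSub H G → P H)

Fω : ℕ → ∀ {n} → Graph n → Set
Fω k = MinForbidden (InΩ k)

Fχ : ℕ → ∀ {n} → Graph n → Set
Fχ k = MinForbidden (InΥ k)

Dominating : ∀ {n} → Graph n → Fin n → Set
Dominating G v = ∀ u → u ≢ v → adj G v u ≡ true

delete : ∀ {m} → Graph (suc m) → Fin (suc m) → Graph m
delete G v = record
  { adj    = λ i j → adj G (Data.Fin.punchIn v i) (Data.Fin.punchIn v j)
  ; sym    = λ i j → sym G _ _
  ; irrefl = λ i → irrefl G _
  }

cone : ∀ {m} → Graph m → Graph (suc m)
cone {m} G = record { adj = a ; sym = s ; irrefl = r }
  where
  a : Fin (suc m) → Fin (suc m) → Bool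
  a zero    zero    = false
  a zero    (suc j) = true
  a (suc i) zero    = true
  a (suc i) (suc j) = adj G i j
  s : ∀ i j → a i j ≡ a j i
  s zero    zero    = refl
  s zero    (suc j) = refl
  s (suc i) zero    = refl
  s (suc i) (suc j) = sym G i j
  r : ∀ i → a i i ≡ false
  r zero    = refl
  r (suc i) = irrefl G i

edgeAdj : ∀ {k} → List (ℕ × ℕ) → Fin k → Fin k → Bool
edgeAdj es i j = any (λ e → ((proj₁ e ≡ᵇ toℕ i) ∧ (proj₂ e ≡ᵇ toℕ j))
                          ∨ ((proj₁ e ≡ᵇ toℕ j) ∧ (proj₂ e ≡ᵇ toℕ i))) es
                 ∧ B.not (toℕ i ≡ᵇ toℕ j)

symDec : (k : ℕ) (es : List (ℕ × ℕ)) → Dec (∀ (i j : Fin k) → edgeAdj es i j ≡ edgeAdj es j i)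
symDec k es = all? λ i → all? λ j → edgeAdj es i j B.≟ edgeAdj es j i

irrDec : (k : ℕ) (es : List (ℕ × ℕ)) → Dec (∀ (i : Fin k) → edgeAdj es i i ≡ false)
irrDec k es = all? λ i → edgeAdj es i i B.≟ false

fromEdges : (k : ℕ) (es : List (ℕ × ℕ)) → {s : True (symDec k es)} → {r : True (irrDec k es)} → Graph k
fromEdges k es {s} {r} = record { adj = edgeAdj es ; sym = toWitness s ; irrefl = toWitness r }

E4 : Graph 4
E4 = fromEdges 4 []

K2K2K1 : Graph 5
K2K2K1 = fromEdges 5 ((0 , 1) ∷ (2 , 3) ∷ [])

K23 : Graph 5
K23 = fromEdges 5 ((0 , 2) ∷ (0 , 3) ∷ (0 , 4) ∷ (1 , 2) ∷ (1 , 3) ∷ (1 , 4) ∷ [])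

-- K6 minus the perfect matching {01, 23, 45}
K6-3e : Graph 6
K6-3e = fromEdges 6 ((0 , 2) ∷ (0 , 3) ∷ (0 , 4) ∷ (0 , 5) ∷ (1 , 2) ∷ (1 , 3) ∷ (1 , 4) ∷ (1 , 5)
                   ∷ (2 , 4) ∷ (2 , 5) ∷ (3 , 4) ∷ (3 , 5) ∷ [])

-- 3-sun: triangle 0,1,2; 3 ~ 0,1; 4 ~ 1,2; 5 ~ 2,0
S3 : Graph 6
S3 = fromEdges 6 ((0 , 1) ∷ (1 , 2) ∷ (2 , 0) ∷ (3 , 0) ∷ (3 , 1) ∷ (4 , 1) ∷ (4 , 2) ∷ (5 , 2) ∷ (5 , 0) ∷ [])

K3K3 : Graph 6
K3K3 = fromEdges 6 ((0 , 1) ∷ (1 , 2) ∷ (2 , 0) ∷ (3 , 4) ∷ (4 , 5) ∷ (5 , 3) ∷ [])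

-- C5 = 0-1-2-3-4-0 plus vertex 5 adjacent to 0,1,2
C5-3 : Graph 6
C5-3 = fromEdges 6 ((0 , 1) ∷ (1 , 2) ∷ (2 , 3) ∷ (3 , 4) ∷ (4 , 0) ∷ (5 , 0) ∷ (5 , 1) ∷ (5 , 2) ∷ [])

-- C5 plus vertex 5 adjacent to 0,1,2,3
C5-4 : Graph 6
C5-4 = fromEdges 6 ((0 , 1) ∷ (1 , 2) ∷ (2 , 3) ∷ (3 , 4) ∷ (4 , 0) ∷ (5 , 0) ∷ (5 , 1) ∷ (5 , 2) ∷ (5 , 3) ∷ [])

W5 : Graph 6
W5 = fromEdges 6 ((0 , 1) ∷ (1 , 2) ∷ (2 , 3) ∷ (3 , 4) ∷ (4 , 0)
                 ∷ (5 , 0) ∷ (5 , 1) ∷ (5 , 2) ∷ (5 , 3) ∷ (5 , 4) ∷ [])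

Case1 : ∀ {m} → Graph m → Set
Case1 H = H ≅ E4

Case2 : ∀ {m} → Graph m → Set
Case2 {m} H = m ≡ 5 × SubgraphOf K2K2K1 H × SubgraphOf H K23

Case3 : ∀ {m} → Graph m → Set
Case3 {m} H = m ≡ 6 × SubgraphOf H K6-3e
              × (H ≅ S3 ⊎ SubgraphOf K3K3 H ⊎ H ≅ C5-3 ⊎ H ≅ C5-4)

Characterisation : ∀ {n} → Graph n → Set
Characterisation {zero}  G = ⊥
Characterisation {suc m} G =
  Σ (Fin (suc m)) λ v → Dominating G v × (Case1 (delete G v) ⊎ Case2 (delete G v) ⊎ Case3 (delete G v))

module Submission where

-- Write ν for χ or ω. If Δ(G) ≥ ν(G) + 2 and G is minimal with this property, then a vertex v of maximum degree is
-- dominating, and H = G − v has exactly ν(H) + 3 vertices while no deletion of a vertex of H lowers ν. Conversely, this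
-- suffices for minimality, because adding vertices to an induced subgraph raises ν by at most one per vertex.
-- Let k = ν(H). For ν = χ no colour class of a k-colouring is a singleton, so 2k ≤ k + 3. For ν = ω the maximum cliques of
-- H have no common vertex, so 2k ≤ k + 3 by Hajnal's clique lemma. Hence k ≤ 3, and graphs on at most 6 vertices remain:
-- k = 1 is immediate, k = 2 is settled by exhaustion over all graphs on 5 vertices, and k = 3 by exhaustion over the
-- 6-vertex extensions of a triangle or, when some H − u has none, of a 5-cycle.

open import Defs
open import Data.Bool using (Bool; true; false; T; _∧_; _∨_; not; if_then_else_)
import Data.Bool as B
open import Data.Bool.Properties using (T-∧; ¬-not)
open import Data.Empty using (⊥; ⊥-elim)
open import Data.Fin using (Fin; zero; suc; fromℕ; punchIn; punchOut; _↑ʳ_; inject≤; combine; remQuot)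
import Data.Fin as F
open import Data.Fin.Properties using (_≟_; all?; any?; suc-injective; 0≢1+n; punchIn-injective; punchOut-injective; punchInᵢ≢i; punchIn-punchOut; injective⇒≤; inject≤-injective; combine-remQuot; <-cmp)
open import Data.Nat using (ℕ; zero; suc; _+_; _*_; _≤_; _<_; z≤n; s≤s)
open import Data.Nat.Solver using (module +-*-Solver)
open import Data.Nat.Properties using (≤-refl; ≤-trans; ≤-reflexive; <-irrefl)
import Data.Nat.Properties as ℕ
open import Data.Product using (Σ; ∃; _×_; _,_; proj₁; proj₂)
open import Data.Sum using (_⊎_; inj₁; inj₂)
open import Data.Vec using (Vec; []; _∷_; lookup; tabulate)
open import Data.Vec.Functional using () renaming (_∷_ to _◂_)
open import Data.Vec.Properties using (lookup∘tabulate)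
open import Function using (_∘_; id)
open import Function.Bundles using (_⇔_; mk⇔; mk↔ₛ′; Equivalence; Inverse; Injection)
open import Function.Properties.Inverse using (↔-sym; ↔⇒↣)
open import Function.Definitions using (Injective)
open import Relation.Binary using (tri<; tri≈; tri>)
open import Relation.Binary.PropositionalEquality using (_≡_; _≢_; refl; cong; cong₂; trans; subst) renaming (sym to ≡-sym)
open import Relation.Nullary using (¬_; Dec; yes; no; does; contradiction)
open import Relation.Nullary.Decidable using (map′; _×-dec_; _⊎-dec_; _→-dec_; ¬?; isYes; toWitness; from-yes; from-no; decidable-stable)

private variable
  j k m n : ℕ

-- Injections between finite sets

Inj : ∀ {A B : Set} → (A → B) → Set
Inj f = Injective _≡_ _≡_ f

-- If every point were hit, choosing preimages would inject `Fin n` into `Fin m`.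
missed : {f : Fin m → Fin n} → m < n → ∃ λ u → ∀ i → f i ≢ u
missed {f = f} m<n with any? (λ u → all? λ i → ¬? (f i ≟ u))
... | yes found = found
... | no none = contradiction (injective⇒≤ g-inj) (ℕ.<⇒≱ m<n)
  where
  hit : ∀ u → ∃ λ i → f i ≡ u
  hit u = decidable-stable (any? λ i → f i ≟ u) λ ¬∃ → none (u , λ i eq → ¬∃ (i , eq))
  g-inj : Inj (λ u → proj₁ (hit u))
  g-inj {u} {v} eq = trans (≡-sym (proj₂ (hit u))) (trans (cong f eq) (proj₂ (hit v)))

injective⇒surjective : {f : Fin n → Fin n} → Inj f → ∀ u → ∃ λ i → f i ≡ u
injective⇒surjective {suc n} {f} inj u = decidable-stable (any? λ i → f i ≟ u) λ ¬∃ →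
  let u≢ i eq = ¬∃ (i , ≡-sym eq) in
  ℕ.<-irrefl refl (injective⇒≤ λ {i} {j} eq → inj (punchOut-injective (u≢ i) (u≢ j) eq))

inj-◂ : {f : Fin m → Fin n} {u : Fin n} → Inj f → (∀ i → f i ≢ u) → Inj (u ◂ f)
inj-◂ inj u∉ {zero}  {zero}  eq = refl
inj-◂ inj u∉ {zero}  {suc j} eq = contradiction (≡-sym eq) (u∉ j)
inj-◂ inj u∉ {suc i} {zero}  eq = contradiction eq (u∉ i)
inj-◂ inj u∉ {suc i} {suc j} eq = cong suc (inj eq)

-- Lets `exhaust` relabel a graph so that a given induced copy occupies the last positions.
extendInj : ∀ j {f : Fin m → Fin n} → Inj f → j + m ≤ n →
            Σ (Fin (j + m) → Fin n) λ g → Inj g × (∀ i → g (j ↑ʳ i) ≡ f i)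
extendInj zero    {f} inj le = f , inj , λ _ → refl
extendInj (suc j) {f} inj le =
  let g , g-inj , g-f = extendInj j inj (ℕ.<⇒≤ le)
      u , u∉ = missed {f = g} le
  in u ◂ g , inj-◂ g-inj u∉ , g-f

-- Induced subgraphs

-- InducedSub unfolds to a Σ-type, which hides its two graphs from unification; this wrapper keeps them visible.
record _⊑_ (H : Graph m) (G : Graph n) : Set where
  constructor ⟨_⟩
  field
    sub : InducedSub H G
  map : Fin m → Fin n
  map = proj₁ sub
  map-inj : Inj map
  map-inj = proj₁ (proj₂ sub)
  map-adj : ∀ i j → adj H i j ≡ adj G (map i) (map j)
  map-adj = proj₂ (proj₂ sub)
open _⊑_

private variable
  F : Graph k
  H : Graph m
  G : Graph n

induce : Graph n → (Fin m → Fin n) → Graph m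
induce G f = record { adj = λ i j → adj G (f i) (f j) ; sym = λ i j → sym G _ _ ; irrefl = λ i → irrefl G _ }

induce⊑ : (G : Graph n) {f : Fin m → Fin n} → Inj f → induce G f ⊑ G
induce⊑ G {f} inj = ⟨ f , inj , (λ _ _ → refl) ⟩

⊑-refl : G ⊑ G
⊑-refl = ⟨ id , id , (λ _ _ → refl) ⟩

⊑-trans : F ⊑ H → H ⊑ G → F ⊑ G
⊑-trans s t = ⟨ map t ∘ map s , map-inj s ∘ map-inj t , (λ i j → trans (map-adj s i j) (map-adj t _ _)) ⟩

⊑-size : {H : Graph m} {G : Graph n} → H ⊑ G → m ≤ n
⊑-size s = injective⇒≤ (map-inj s)

module _ {H G : Graph n} (s : H ⊑ G) where

  private
    hit = injective⇒surjective (map-inj s)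

    inv : Fin n → Fin n
    inv u = proj₁ (hit u)

    map-inv : ∀ u → map s (inv u) ≡ u
    map-inv u = proj₂ (hit u)

  -- An injection of a finite set into itself is onto, so an embedding between graphs of equal order
  -- can be reversed.
  ⊑-inverse : G ⊑ H
  ⊑-inverse = ⟨ inv , (λ eq → trans (≡-sym (map-inv _)) (trans (cong (map s) eq) (map-inv _)))
              , (λ u v → ≡-sym (trans (map-adj s _ _) (cong₂ (adj G) (map-inv u) (map-inv v)))) ⟩

  ⊑⇒≅ : H ≅ G
  ⊑⇒≅ = mk↔ₛ′ (map s) inv map-inv (λ i → map-inj s (map-inv (map s i))) , map-adj s

≅⇒⊑ : H ≅ G → H ⊑ G
≅⇒⊑ (e , e-adj) = ⟨ Inverse.to e , Injection.injective (↔⇒↣ e) , e-adj ⟩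

≅-size : {H : Graph m} {G : Graph n} → H ≅ G → m ≡ n
≅-size (e , _) = ℕ.≤-antisym (injective⇒≤ (Injection.injective (↔⇒↣ e))) (injective⇒≤ (Injection.injective (↔⇒↣ (↔-sym e))))

⊑⇒⊆ : H ⊑ G → SubgraphOf H G
⊑⇒⊆ s = map s , map-inj s , λ i j a → trans (≡-sym (map-adj s i j)) a

⊆-trans : ∀ (F : Graph k) (H : Graph m) (G : Graph n) → SubgraphOf F H → SubgraphOf H G → SubgraphOf F G
⊆-trans _ _ _ (f , f-inj , f-adj) (g , g-inj , g-adj) =
  g ∘ f , f-inj ∘ g-inj , λ i j → g-adj _ _ ∘ f-adj i j

delete⊑ : (G : Graph (suc n)) (u : Fin (suc n)) → delete G u ⊑ G
delete⊑ G u = ⟨ punchIn u , punchIn-injective u _ _ , (λ _ _ → refl) ⟩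

⊑-delete : {G : Graph (suc n)} (s : H ⊑ G) {u : Fin (suc n)} → (∀ i → map s i ≢ u) → H ⊑ delete G u
⊑-delete {G = G} s {u} u∉ =
  ⟨ (λ i → punchOut (u≢ i)) , (λ {i} {j} → map-inj s ∘ punchOut-injective (u≢ i) (u≢ j))
  , (λ i j → trans (map-adj s i j) (≡-sym (cong₂ (adj G) (punchIn-punchOut (u≢ i)) (punchIn-punchOut (u≢ j))))) ⟩
  where
  u≢ : ∀ i → u ≢ map s i
  u≢ i eq = u∉ i (≡-sym eq)

delete-mono : {H : Graph (suc m)} {G : Graph (suc n)} (s : H ⊑ G) → ∀ u → delete H u ⊑ delete G (map s u)
delete-mono {H = H} s u = ⊑-delete (⊑-trans (delete⊑ H u) s) λ i eq → punchInᵢ≢i u i (map-inj s eq)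

-- Cliques and colourings under embeddings

clique-mono : H ⊑ G → ∀ {s} → HasClique H s → HasClique G s
clique-mono t (c , c-inj , c-adj) =
  map t ∘ c , c-inj ∘ map-inj t , λ i j i≢j → trans (≡-sym (map-adj t _ _)) (c-adj i j i≢j)

clique-≤ : (G : Graph n) {s t : ℕ} → s ≤ t → HasClique G t → HasClique G s
clique-≤ G s≤t (c , c-inj , c-adj) =
  (λ i → c (inject≤ i s≤t)) , (λ eq → inject≤-injective s≤t s≤t _ _ (c-inj eq)) ,
  λ i j i≢j → c-adj _ _ (i≢j ∘ inject≤-injective s≤t s≤t _ _)

colorable-⊆ : ∀ (H : Graph m) (G : Graph n) → SubgraphOf H G → ∀ {c} → Colorable G c → Colorable H c
colorable-⊆ _ _ (f , _ , f-adj) (col , proper) = col ∘ f , λ i j → proper _ _ ∘ f-adj i j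

colorable-mono : H ⊑ G → ∀ {c} → Colorable G c → Colorable H c
colorable-mono {H = H} {G = G} s = colorable-⊆ H G (⊑⇒⊆ s)

colorable-≤ : (G : Graph n) {c d : ℕ} → c ≤ d → Colorable G c → Colorable G d
colorable-≤ G c≤d (col , proper) =
  (λ i → inject≤ (col i) c≤d) , λ i j a eq → proper i j a (inject≤-injective c≤d c≤d _ _ eq)

clique≤colors : (G : Graph n) {s c : ℕ} → HasClique G s → Colorable G c → s ≤ c
clique≤colors G (f , inj , f-adj) (col , proper) = injective⇒≤ {f = col ∘ f} λ {i} {j} eq →
  decidable-stable (i ≟ j) λ i≢j → proper _ _ (f-adj i j i≢j) eq

-- Decision procedures

-- Backtracking: the unary constraints collect the binary ones against the values chosen so far.
search : ∀ m {U : Fin m → Fin n → Set} {R : Fin m → Fin m → Fin n → Fin n → Set} →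
         (∀ i x → Dec (U i x)) → (∀ i j x y → Dec (R i j x y)) →
         Dec (Σ (Fin m → Fin n) λ f → (∀ i → U i (f i)) × (∀ {i j} → i F.< j → R i j (f i) (f j)))
search zero U? R? = yes ((λ ()) , (λ ()) , λ { {()} })
search {n} (suc m) {U} {R} U? R? = map′ to from (any? λ x → U? zero x ×-dec
    search m {U′ x} (λ i y → U? (suc i) y ×-dec R? zero (suc i) x y) (λ i j → R? (suc i) (suc j)))
  where
  U′ : Fin n → Fin m → Fin n → Set
  U′ x i y = U (suc i) y × R zero (suc i) x y
  Tail : Fin n → (Fin m → Fin n) → Set
  Tail x f = (∀ i → U′ x i (f i)) × (∀ {i j} → i F.< j → R (suc i) (suc j) (f i) (f j))
  to : Σ (Fin n) (λ x → U zero x × Σ (Fin m → Fin n) (Tail x)) →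
       Σ (Fin (suc m) → Fin n) λ f → (∀ i → U i (f i)) × (∀ {i j} → i F.< j → R i j (f i) (f j))
  to (x , u , f , us , rs) = (x ◂ f)
    , (λ { zero → u ; (suc i) → proj₁ (us i) })
    , λ { {zero} {suc j} _ → proj₂ (us j) ; {suc i} {suc j} (s≤s i<j) → rs i<j }
  from : Σ (Fin (suc m) → Fin n) (λ f → (∀ i → U i (f i)) × (∀ {i j} → i F.< j → R i j (f i) (f j))) →
         Σ (Fin n) (λ x → U zero x × Σ (Fin m → Fin n) (Tail x))
  from (f , us , rs) = f zero , us zero , f ∘ suc
    , (λ i → us (suc i) , rs (s≤s z≤n)) , (λ i<j → rs (s≤s i<j))

-- `search` examines each pair once, in increasing order; `diag` and `swap` supply the remaining
-- pairs.
symmetric? : ∀ m {R : Fin m → Fin m → Fin n → Fin n → Set} → (∀ i j x y → Dec (R i j x y)) →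
             (∀ i x → R i i x x) → (∀ {i j x y} → R i j x y → R j i y x) →
             Dec (Σ (Fin m → Fin n) λ f → ∀ i j → R i j (f i) (f j))
symmetric? m {R} R? diag swap =
  map′ (λ (f , _ , r) → f , λ i j → full f r i j (<-cmp i j)) (λ (f , r) → f , (λ i → r i i) , λ {i} {j} _ → r i j)
       (search m {λ i x → R i i x x} {R} (λ i x → yes (diag i x)) R?)
  where
  full : ∀ f → (∀ {i j} → i F.< j → R i j (f i) (f j)) → ∀ i j → _ → R i j (f i) (f j)
  full f r i j (tri< i<j _ _) = r i<j
  full f r i .i (tri≈ _ refl _) = diag i (f i)
  full f r i j (tri> _ _ j<i) = swap (r j<i)

-- Equality for `_~_` gives induced copies, implication gives subgraphs. Injectivity is folded into
-- the same pairwise constraint.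
embedding? : (_~_ : Bool → Bool → Set) → (∀ a b → Dec (a ~ b)) → false ~ false → (H : Graph m) (G : Graph n) →
             Dec (Σ (Fin m → Fin n) λ f → Inj f × (∀ i j → adj H i j ~ adj G (f i) (f j)))
embedding? {m} _~_ _~?_ ff H G =
  map′ (λ (f , r) → f , (λ {i} {j} → proj₁ (r i j)) , λ i j → proj₂ (r i j))
       (λ (f , inj , r) → f , λ i j → inj , r i j)
       (symmetric? m {λ i j x y → (x ≡ y → i ≡ j) × (adj H i j ~ adj G x y)}
         (λ i j x y → ((x ≟ y) →-dec (i ≟ j)) ×-dec (adj H i j ~? adj G x y))
         (λ i x → (λ _ → refl) , diag i x)
         λ {i} {j} {x} {y} (inj , r) → (λ eq → ≡-sym (inj (≡-sym eq))) , swap i j x y r)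
  where
  diag : ∀ i x → adj H i i ~ adj G x x
  diag i x rewrite irrefl H i | irrefl G x = ff
  swap : ∀ i j x y → adj H i j ~ adj G x y → adj H j i ~ adj G y x
  swap i j x y r rewrite sym H i j | sym G x y = r

inducedSub? : (H : Graph m) (G : Graph n) → Dec (InducedSub H G)
inducedSub? = embedding? _≡_ B._≟_ refl

subgraphOf? : (H : Graph m) (G : Graph n) → Dec (SubgraphOf H G)
subgraphOf? = embedding? (λ a b → a ≡ true → b ≡ true) (λ a b → (a B.≟ true) →-dec (b B.≟ true)) id

colorable? : (G : Graph n) → ∀ c → Dec (Colorable G c)
colorable? {n} G c = symmetric? n (λ i j x y → (adj G i j B.≟ true) →-dec ¬? (x ≟ y))
  (λ i x a → contradiction (trans (≡-sym (irrefl G i)) a) λ ())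
  (λ {i} {j} r a eq → r (trans (sym G i j) a) (≡-sym eq))

-- The predicate is a candidate set, which the recursion of `cliqueIn?` narrows to the neighbours of
-- a chosen vertex.
CliqueIn : Graph n → (Fin n → Bool) → ℕ → Set
CliqueIn {n} G p s = Σ (HasClique G s) λ (f , _) → ∀ i → p (f i) ≡ true

module _ (G : Graph (suc n)) (p : Fin (suc n) → Bool) (s : ℕ) where

  private G′ = delete G zero

  cliqueWith₀ : p zero ≡ true → CliqueIn G′ (λ i → adj G zero (suc i) ∧ p (suc i)) s → CliqueIn G p (suc s)
  cliqueWith₀ p0 ((f , inj , f-adj) , f-p) =
    (zero ◂ (suc ∘ f) , inj-◂ (inj ∘ suc-injective) (λ _ ()) ,
    λ { zero zero ne → contradiction refl ne
      ; zero (suc j) _ → proj₁ (both j)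
      ; (suc i) zero _ → trans (sym G _ _) (proj₁ (both i))
      ; (suc i) (suc j) ne → f-adj i j (ne ∘ cong suc) }) ,
    λ { zero → p0 ; (suc i) → proj₂ (both i) }
    where
    both : ∀ i → adj G zero (suc (f i)) ≡ true × p (suc (f i)) ≡ true
    both i with adj G zero (suc (f i)) | f-p i
    ... | true | q = refl , q

  cliqueWithout₀ : CliqueIn G′ (p ∘ suc) (suc s) → CliqueIn G p (suc s)
  cliqueWithout₀ ((f , inj , f-adj) , f-p) = (suc ∘ f , inj ∘ suc-injective , f-adj) , f-p

  cliqueSplit : CliqueIn G p (suc s) →
    (p zero ≡ true × CliqueIn G′ (λ i → adj G zero (suc i) ∧ p (suc i)) s) ⊎ CliqueIn G′ (p ∘ suc) (suc s)
  cliqueSplit ((f , inj , f-adj) , f-p) with any? (λ i → f i ≟ zero)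
  ... | no ∌0 = inj₂ ((h , (λ eq → inj (trans (≡-sym (f-h _)) (trans (cong suc eq) (f-h _)))) ,
                  λ i j ne → trans (cong₂ (adj G) (f-h i) (f-h j)) (f-adj i j ne)) ,
                  λ i → trans (cong p (f-h i)) (f-p i))
    where
    h : Fin (suc s) → Fin n
    h i = punchOut {i = zero} λ eq → ∌0 (i , ≡-sym eq)
    f-h : ∀ i → suc (h i) ≡ f i
    f-h i = punchIn-punchOut {i = zero} λ eq → ∌0 (i , ≡-sym eq)
  ... | yes (i₀ , eq₀) = inj₁ (trans (cong p (≡-sym eq₀)) (f-p i₀) ,
                  (h , (λ eq → punchIn-injective i₀ _ _ (inj (trans (≡-sym (f-h _)) (trans (cong suc eq) (f-h _))))) ,
                  λ i j ne → trans (cong₂ (adj G) (f-h i) (f-h j)) (f-adj _ _ (ne ∘ punchIn-injective i₀ i j))) ,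
                  λ i → trans (cong (λ x → adj G zero x ∧ p x) (f-h i))
                              (cong₂ _∧_ (trans (cong (λ x → adj G x (f (punchIn i₀ i))) (≡-sym eq₀)) (f-adj _ _ (punchInᵢ≢i i₀ i ∘ ≡-sym)))
                                         (f-p _)))
    where
    ≢0 : ∀ i → zero ≢ f (punchIn i₀ i)
    ≢0 i eq = punchInᵢ≢i i₀ i (inj (trans (≡-sym eq) (≡-sym eq₀)))
    h : Fin s → Fin n
    h i = punchOut (≢0 i)
    f-h : ∀ i → suc (h i) ≡ f (punchIn i₀ i)
    f-h i = punchIn-punchOut (≢0 i)

cliqueIn? : (G : Graph n) (p : Fin n → Bool) → ∀ s → Dec (CliqueIn G p s)
cliqueIn? G p zero = yes (((λ ()) , (λ { {()} }) , λ ()) , λ ())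
cliqueIn? {zero} G p (suc s) = no λ ((f , _) , _) → contradiction (f zero) λ ()
cliqueIn? {suc n} G p (suc s) =
  map′ (λ { (inj₁ (p0 , c)) → cliqueWith₀ G p s p0 c ; (inj₂ c) → cliqueWithout₀ G p s c }) (cliqueSplit G p s)
       ((p zero B.≟ true ×-dec cliqueIn? (delete G zero) (λ i → adj G zero (suc i) ∧ p (suc i)) s)
        ⊎-dec cliqueIn? (delete G zero) (p ∘ suc) (suc s))

hasClique? : (G : Graph n) → ∀ s → Dec (HasClique G s)
hasClique? G s = map′ proj₁ (λ c → c , λ _ → refl) (cliqueIn? G (λ _ → true) s)

-- Exhaustion over the extensions of a fixed graph by j further vertices

extend : (Fin n → Bool) → Graph n → Graph (suc n)
extend {n} r G = record { adj = a ; sym = s ; irrefl = ir }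
  where
  a : Fin (suc n) → Fin (suc n) → Bool
  a zero    zero    = false
  a zero    (suc j) = r j
  a (suc i) zero    = r i
  a (suc i) (suc j) = adj G i j
  s : ∀ i j → a i j ≡ a j i
  s zero    zero    = refl
  s zero    (suc j) = refl
  s (suc i) zero    = refl
  s (suc i) (suc j) = sym G i j
  ir : ∀ i → a i i ≡ false
  ir zero    = refl
  ir (suc i) = irrefl G i

everyVec : ∀ n → (Vec Bool n → Bool) → Bool
everyVec zero    p = p []
everyVec (suc n) p = everyVec n (p ∘ (true ∷_)) ∧ everyVec n (p ∘ (false ∷_))

everyVec-sound : ∀ n (p : Vec Bool n → Bool) → T (everyVec n p) → ∀ v → T (p v)
everyVec-sound zero    p t []          = t
everyVec-sound (suc n) p t (true  ∷ v) = everyVec-sound n _ (proj₁ (Equivalence.to T-∧ t)) v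
everyVec-sound (suc n) p t (false ∷ v) =
  everyVec-sound n _ (proj₂ (Equivalence.to (T-∧ {everyVec n (p ∘ (true ∷_))}) t)) v

-- Boolean-valued, because a nested Dec would keep the evidence of all cases in memory.
everyExtension : ∀ j → Graph k → (Graph (j + k) → Bool) → Bool
everyExtension zero    X p = p X
everyExtension (suc j) X p = everyExtension j X λ G → everyVec _ λ r → p (extend (lookup r) G)

-- The enumeration tabulates the adjacency rows and so meets a copy `G′` of `G` rather than `G`
-- itself; `exhaust` transports the property along that copy.
everyExtension-sound : ∀ j (X : Graph k) (p : Graph (j + k) → Bool) → T (everyExtension j X p) →
  (G : Graph (j + k)) → (∀ i i′ → adj X i i′ ≡ adj G (j ↑ʳ i) (j ↑ʳ i′)) →
  Σ (Graph (j + k)) λ G′ → T (p G′) × G′ ⊑ G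
everyExtension-sound zero    X p t G X≡ = X , t , ⟨ id , id , X≡ ⟩
everyExtension-sound {k} (suc j) X p t G X≡
  with everyExtension-sound j X _ t (delete G zero) X≡
... | G′ , t′ , s = extend (lookup r) G′ , everyVec-sound _ _ t′ r
                  , ⟨ zero ◂ (suc ∘ map s) , inj-◂ (map-inj s ∘ suc-injective) (λ _ ()) , same ⟩
  where
  r : Vec Bool (j + k)
  r = tabulate λ i → adj G zero (suc (map s i))
  same : ∀ a b → adj (extend (lookup r) G′) a b ≡ adj G ((zero ◂ (suc ∘ map s)) a) ((zero ◂ (suc ∘ map s)) b)
  same zero    zero    = ≡-sym (irrefl G zero)
  same zero    (suc b) = lookup∘tabulate _ b
  same (suc a) zero    = trans (lookup∘tabulate _ a) (sym G _ _)
  same (suc a) (suc b) = map-adj s a b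

-- On graphs of equal order `_⊑_` amounts to isomorphism.
Invariant : (Graph n → Set) → Set
Invariant {n} P = ∀ {G H : Graph n} → G ⊑ H → P G → P H

-- The implicit argument is filled by evaluating the Boolean check, so each use performs its case
-- analysis during type checking.
exhaust : ∀ j (X : Graph k) {P : Graph (j + k) → Set} (P? : ∀ G → Dec (P G)) → Invariant P →
          {_ : T (everyExtension j X λ G → isYes (P? G))} → ∀ G → X ⊑ G → P G
exhaust j X P? P-inv {t} G s =
  let g , g-inj , g-f = extendInj j (map-inj s) ≤-refl
      G′ , p , s′ = everyExtension-sound j X _ t (induce G g) λ i i′ →
                      trans (map-adj s i i′) (≡-sym (cong₂ (adj G) (g-f i) (g-f i′)))
  in P-inv (⊑-trans s′ (induce⊑ G g-inj)) (toWitness p)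

module _ {P Q : Graph n → Set} (P-inv : Invariant P) (Q-inv : Invariant Q) where

  inv-→ : Invariant (λ G → P G → Q G)
  inv-→ s f p = Q-inv s (f (P-inv (⊑-inverse s) p))

  inv-× : Invariant (λ G → P G × Q G)
  inv-× s (p , q) = P-inv s p , Q-inv s q

  inv-⊎ : Invariant (λ G → P G ⊎ Q G)
  inv-⊎ s (inj₁ p) = inj₁ (P-inv s p)
  inv-⊎ s (inj₂ q) = inj₂ (Q-inv s q)

inv-¬ : {P : Graph n → Set} → Invariant P → Invariant (λ G → ¬ P G)
inv-¬ P-inv s ¬p p = ¬p (P-inv (⊑-inverse s) p)

inv-delete : {P : Graph n → Set} → Invariant P → Invariant (λ G → ∀ u → P (delete G u))
inv-delete P-inv s all u = P-inv (⊑-inverse (delete-mono (⊑-inverse s) u)) (all _)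

inv-clique : ∀ {s} → Invariant {n} (λ G → HasClique G s)
inv-clique s = clique-mono s

inv-colorable : ∀ {c} → Invariant {n} (λ G → Colorable G c)
inv-colorable s = colorable-mono (⊑-inverse s)

inv-⊑ : (X : Graph m) → Invariant {n} (InducedSub X)
inv-⊑ X {G} {H} s t = sub {H = X} {G = H} (⊑-trans {H = G} ⟨ t ⟩ s)

inv-⊇ : (X : Graph m) → Invariant {n} (SubgraphOf X)
inv-⊇ X {G} {H} s t = ⊆-trans X G H t (⊑⇒⊆ s)

inv-⊆ : (X : Graph m) → Invariant {n} (λ G → SubgraphOf G X)
inv-⊆ X {G} {H} s = ⊆-trans H G X (⊑⇒⊆ (⊑-inverse s))

-- Small graphs

complete : ∀ n → Graph n
complete n = record { adj = λ i j → not (does (i ≟ j)) ; sym = symmetric ; irrefl = irreflexive }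
  where
  symmetric : ∀ (i j : Fin n) → not (does (i ≟ j)) ≡ not (does (j ≟ i))
  symmetric i j with i ≟ j | j ≟ i
  ... | yes _   | yes _   = refl
  ... | yes i≡j | no j≢i  = contradiction (≡-sym i≡j) j≢i
  ... | no i≢j  | yes j≡i = contradiction (≡-sym j≡i) i≢j
  ... | no _    | no _    = refl
  irreflexive : ∀ (i : Fin n) → not (does (i ≟ i)) ≡ false
  irreflexive i with i ≟ i
  ... | yes _  = refl
  ... | no i≢i = contradiction refl i≢i

clique⇒⊑ : (G : Graph n) → ∀ {s} → HasClique G s → complete s ⊑ G
clique⇒⊑ G (f , inj , f-adj) = ⟨ f , inj , same ⟩
  where
  same : ∀ i j → not (does (i ≟ j)) ≡ adj G (f i) (f j)
  same i j with i ≟ j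
  ... | yes refl = ≡-sym (irrefl G (f i))
  ... | no i≢j   = ≡-sym (f-adj i j i≢j)

-- Makes exhaustion over all graphs of a given order a case of exhaustion over extensions.
∅⊑ : (G : Graph n) → complete 0 ⊑ G
∅⊑ G = ⟨ (λ ()) , (λ { {()} }) , (λ ()) ⟩

-- Defined as the wheel without its hub, so that facts about deleting a dominating vertex apply to
-- `W5` directly.
C5 : Graph 5
C5 = delete W5 (fromℕ 5)

-- Opaque, so that the exhaustive checks are not unfolded where their results are used.
abstract

  -- A shortest odd cycle is induced, and on five vertices it has length 3 or 5.
  triangle-or-bipartite-or-C5 : (G : Graph 5) → HasClique G 3 ⊎ Colorable G 2 ⊎ InducedSub C5 G
  triangle-or-bipartite-or-C5 G =
    exhaust 5 (complete 0) (λ G → hasClique? G 3 ⊎-dec colorable? G 2 ⊎-dec inducedSub? C5 G)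
      (inv-⊎ inv-clique (inv-⊎ inv-colorable (inv-⊑ C5))) G (∅⊑ G)

  -- Edges without a common vertex form a triangle or include two disjoint ones. Without a triangle
  -- or `C5` the graph is bipartite, and two disjoint edges put at least two vertices on each side,
  -- so the sides have sizes 2 and 3.
  five-vertices : (G : Graph 5) → (∀ u → HasClique (delete G u) 2) →
    HasClique G 3 ⊎ InducedSub C5 G ⊎ (SubgraphOf K2K2K1 G × SubgraphOf G K23)
  five-vertices G =
    exhaust 5 (complete 0)
      (λ G → all? (λ u → hasClique? (delete G u) 2) →-dec
             (hasClique? G 3 ⊎-dec inducedSub? C5 G ⊎-dec (subgraphOf? K2K2K1 G ×-dec subgraphOf? G K23)))
      (inv-→ (inv-delete inv-clique) (inv-⊎ inv-clique (inv-⊎ (inv-⊑ C5) (inv-× (inv-⊇ K2K2K1) (inv-⊆ K23))))) G (∅⊑ G)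

  -- After deleting any cycle vertex an odd cycle must run through the sixth vertex, which forces
  -- three or four consecutive neighbours, or all five; the last gives `W5`, which has no
  -- 3-colouring. The colour classes all have size 2, whence `K6-3e`.
  six-vertices-C5 : (G : Graph 6) → C5 ⊑ G → (∀ u → ¬ Colorable (delete G u) 2) → Colorable G 3 →
    SubgraphOf G K6-3e × (InducedSub C5-3 G ⊎ InducedSub C5-4 G)
  six-vertices-C5 =
    exhaust 1 C5
      (λ G → all? (λ u → ¬? (colorable? (delete G u) 2)) →-dec (colorable? G 3 →-dec
             (subgraphOf? G K6-3e ×-dec (inducedSub? C5-3 G ⊎-dec inducedSub? C5-4 G))))
      (inv-→ (inv-delete (inv-¬ inv-colorable)) (inv-→ inv-colorable (inv-× (inv-⊆ K6-3e) (inv-⊎ (inv-⊑ C5-3) (inv-⊑ C5-4)))))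

  -- The triangles have no common vertex. Either two are disjoint, or they meet pairwise, which
  -- without a four-clique happens only in the 3-sun. Starting from one triangle leaves 2^12 graphs
  -- to check instead of 2^15.
  six-vertices-triangle : (G : Graph 6) → complete 3 ⊑ G → (∀ u → HasClique (delete G u) 3) →
    HasClique G 4 ⊎ SubgraphOf G K6-3e × (InducedSub S3 G ⊎ SubgraphOf K3K3 G)
  six-vertices-triangle =
    exhaust 3 (complete 3)
      (λ G → all? (λ u → hasClique? (delete G u) 3) →-dec (hasClique? G 4 ⊎-dec
             (subgraphOf? G K6-3e ×-dec (inducedSub? S3 G ⊎-dec subgraphOf? K3K3 G))))
      (inv-→ (inv-delete inv-clique) (inv-⊎ inv-clique (inv-× (inv-⊆ K6-3e) (inv-⊎ (inv-⊑ S3) (inv-⊇ K3K3)))))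

-- Degrees

indicator : Bool → ℕ
indicator b = if b then 1 else 0

count-punchIn : ∀ (p : Fin (suc n) → Bool) u → count p ≡ indicator (p u) + count (p ∘ punchIn u)
count-punchIn p zero = refl
count-punchIn {suc n} p (suc u) = trans (cong (indicator (p zero) +_) (count-punchIn (p ∘ suc) u))
  (x∙yz≈y∙xz (indicator (p zero)) (indicator (p (suc u))) _)
  where open import Algebra.Properties.CommutativeSemigroup ℕ.+-commutativeSemigroup

count-inj : {f : Fin m → Fin n} → Inj f → ∀ p q → (∀ i → p i ≡ true → q (f i) ≡ true) → count p ≤ count q
count-inj {zero} inj p q p⇒q = z≤n
count-inj {suc m} {zero} {f} inj p q p⇒q = contradiction (f zero) λ ()
count-inj {suc m} {suc n} {f} inj p q p⇒q = ≤-trans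
  (ℕ.+-mono-≤ (indicator-mono (p⇒q zero)) (count-inj f′-inj (p ∘ suc) (q ∘ punchIn (f zero))
    λ i pi → trans (cong q (punchIn-punchOut (≢f0 i))) (p⇒q (suc i) pi)))
  (≤-reflexive (≡-sym (count-punchIn q (f zero))))
  where
  indicator-mono : ∀ {a b} → (a ≡ true → b ≡ true) → indicator a ≤ indicator b
  indicator-mono {false} imp = z≤n
  indicator-mono {true}  imp rewrite imp refl = ≤-refl
  ≢f0 : ∀ i → f zero ≢ f (suc i)
  ≢f0 i eq = 0≢1+n (inj eq)
  f′-inj : Inj (λ i → punchOut (≢f0 i))
  f′-inj {i} {j} eq = suc-injective (inj (punchOut-injective (≢f0 i) (≢f0 j) eq))

count-≤ : (p : Fin n → Bool) → count p ≤ n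
count-≤ {zero}  p = z≤n
count-≤ {suc n} p with p zero
... | true  = s≤s (count-≤ (p ∘ suc))
... | false = ℕ.m≤n⇒m≤1+n (count-≤ (p ∘ suc))

count-full : (p : Fin n → Bool) → (∀ i → p i ≡ true) → count p ≡ n
count-full {zero}  p all = refl
count-full {suc n} p all rewrite all zero = cong suc (count-full (p ∘ suc) (all ∘ suc))

enumerate : (p : Fin n → Bool) → Σ (Fin (count p) → Fin n) λ g → Inj g × (∀ i → p (g i) ≡ true)
enumerate {zero}  p = (λ ()) , (λ { {()} }) , λ ()
enumerate {suc n} p with p zero in p0 | enumerate (p ∘ suc)
... | true  | g , g-inj , g-p = zero ◂ (suc ∘ g) , inj-◂ (g-inj ∘ suc-injective) (λ _ ())
                              , λ { zero → p0 ; (suc i) → g-p i }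
... | false | g , g-inj , g-p = suc ∘ g , g-inj ∘ suc-injective , g-p

≤maxOver : (f : Fin n → ℕ) → ∀ i → f i ≤ maxOver f
≤maxOver f zero    = ℕ.m≤m⊔n _ _
≤maxOver f (suc i) = ≤-trans (≤maxOver (f ∘ suc) i) (ℕ.m≤n⊔m _ _)

maxOver-lub : (f : Fin n → ℕ) {d : ℕ} → (∀ i → f i ≤ d) → maxOver f ≤ d
maxOver-lub {zero}  f f≤d = z≤n
maxOver-lub {suc n} f f≤d = ℕ.⊔-lub (f≤d zero) (maxOver-lub (f ∘ suc) (f≤d ∘ suc))

Δ-split : (G : Graph n) → ∀ d → (∃ λ w → d < degree G w) ⊎ Δ G ≤ d
Δ-split G d with any? (λ w → d ℕ.<? degree G w)
... | yes found = inj₁ found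
... | no none   = inj₂ (maxOver-lub (degree G) λ w → ℕ.≮⇒≥ λ d<w → none (w , d<w))

degree-mono : (s : H ⊑ G) → ∀ w → degree H w ≤ degree G (map s w)
degree-mono s w = count-inj (map-inj s) _ _ λ i a → trans (≡-sym (map-adj s w i)) a

degree-punchIn : (G : Graph (suc n)) → ∀ v → degree G v ≡ count (adj G v ∘ punchIn v)
degree-punchIn G v = trans (count-punchIn (adj G v) v) (cong (λ b → indicator b + count (adj G v ∘ punchIn v)) (irrefl G v))

degree-dominating : (G : Graph (suc n)) {v : Fin (suc n)} → Dominating G v → degree G v ≡ n
degree-dominating G {v} dom = trans (degree-punchIn G v) (count-full _ λ i → dom _ (punchInᵢ≢i v i))

cone⊑ : {S : Graph m} (s : S ⊑ G) {w : Fin n} → (∀ i → adj {n} G w (map s i) ≡ true) → cone S ⊑ G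
cone⊑ {G = G} {S = S} s {w} w-adj = ⟨ w ◂ map s , inj-◂ (map-inj s) ≢w , same ⟩
  where
  ≢w : ∀ i → map s i ≢ w
  ≢w i eq = contradiction (trans (≡-sym (w-adj i)) (trans (cong (adj G w) eq) (irrefl G w))) λ ()
  same : ∀ i j → adj (cone S) i j ≡ adj G ((w ◂ map s) i) ((w ◂ map s) j)
  same zero    zero    = ≡-sym (irrefl G w)
  same zero    (suc j) = ≡-sym (w-adj j)
  same (suc i) zero    = ≡-sym (trans (sym G _ _) (w-adj i))
  same (suc i) (suc j) = map-adj s i j

-- The argument common to χ and ω, with Number G c for χ(G) = c or ω(G) = c and Bound G c for χ(G) ≤ c or ω(G) ≤ c.

module Extremal
  (Number Bound : ∀ {n} → Graph n → ℕ → Set)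
  (bound  : ∀ {n} {G : Graph n} {c} → Number G c → Bound G c)
  (least  : ∀ {n} {G : Graph n} {c d} → Number G c → Bound G d → c ≤ d)
  (number : ∀ {n} (G : Graph n) → ∃ (Number G))
  (Bound-≤ : ∀ {n} {G : Graph n} {c d} → c ≤ d → Bound G c → Bound G d)
  (Bound-⊑ : ∀ {m n} {H : Graph m} {G : Graph n} {c} → H ⊑ G → Bound G c → Bound H c)
  (grow   : ∀ {n} (G : Graph (suc n)) {c} u → Bound (delete G u) c → Bound G (suc c))
  (shrink : ∀ {n} (G : Graph (suc n)) {c} v → Dominating G v → Bound G c →
            ∃ λ d → c ≡ suc d × Bound (delete G v) d)
  where

  -- Its two instances unfold to `InΥ 2` and `InΩ 2`.
  Class : Graph n → Set
  Class G = ∀ m (H : Graph m) → InducedSub H G → ∀ c → Number H c → Δ H + 1 ≤ c + 2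

  -- Adding a dominating vertex gives number k + 1 and degree 3 + k, which exceeds the permitted
  -- maximum degree k + 2 by one.
  data Critical : Graph m → Set where
    critical : {H : Graph (3 + k)} → Bound H k → (∀ u {c} → Bound (delete H u) c → k ≤ c) → Critical H

  data Forbidden : Graph n → Set where
    forbidden : {G : Graph (suc m)} (v : Fin (suc m)) → Dominating G v → Critical (delete G v) → Forbidden G

  violation : {G : Graph n} {c : ℕ} → Bound G c → ∀ w → 2 + c ≤ degree G w → ¬ Class G
  violation {G = G} {c} b w large inClass = ℕ.<-irrefl refl (begin-strict
    Δ G          <⟨ ≤-reflexive (ℕ.+-comm 1 (Δ G)) ⟩
    Δ G + 1      ≤⟨ inClass _ G (sub (⊑-refl {G = G})) _ (proj₂ (number G)) ⟩
    proj₁ (number G) + 2 ≤⟨ ℕ.+-monoˡ-≤ 2 (least (proj₂ (number G)) b) ⟩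
    c + 2        ≡⟨ ℕ.+-comm c 2 ⟩
    2 + c        ≤⟨ large ⟩
    degree G w   ≤⟨ ≤maxOver (degree G) w ⟩
    Δ G          ∎)
    where open ℕ.≤-Reasoning

  small⇒≤ : {D c : ℕ} → D ≤ 1 + c → D + 1 ≤ c + 2
  small⇒≤ {D} {c} le rewrite ℕ.+-comm D 1 | ℕ.+-comm c 2 = s≤s le

  -- Adding the missing vertices one by one costs at most 1 each.
  Bound-extend : ∀ {m n} {H : Graph m} {G : Graph n} {c} → H ⊑ G → Bound H c → ∃ λ d → Bound G d × d + m ≤ c + n
  Bound-extend {G = G} s b with ℕ.m≤n⇒m<n∨m≡n (⊑-size s)
  ... | inj₂ refl = _ , Bound-⊑ (⊑-inverse s) b , ≤-refl
  Bound-extend {n = suc n} {G = G} {c} s b | inj₁ m<n =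
    let u , u∉ = missed {f = map s} m<n
        d , b′ , le = Bound-extend (⊑-delete s u∉) b
    in suc d , grow G u b′ , ≤-trans (s≤s le) (≤-reflexive (≡-sym (ℕ.+-suc c n)))

  -- Some vertex `w` has degree at least ν(G) + 2. Minimality makes it dominating, and then makes
  -- the rest of the graph critical.
  forbidden⇐ : {G : Graph n} → MinForbidden Class G → Forbidden G
  forbidden⇐ {n} {G} (¬inClass , proper) with number G
  ... | c , χ with Δ-split G (1 + c)
  ...   | inj₂ small = contradiction inClass ¬inClass
    where
    inClass : Class G
    -- Proper induced subgraphs are in the class by minimality; what remains is a copy of `G`.
    inClass m H s d χ′ with ℕ.m≤n⇒m<n∨m≡n (⊑-size {H = H} {G = G} ⟨ s ⟩)
    ... | inj₁ m<n  = proper m H m<n s m H (sub (⊑-refl {G = H})) d χ′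
    ... | inj₂ refl = small⇒≤ (begin
      Δ H   ≤⟨ maxOver-lub (degree H) (λ w → ≤-trans (degree-mono {H = H} {G = G} ⟨ s ⟩ w) (≤maxOver (degree G) _)) ⟩
      Δ G   ≤⟨ small ⟩
      1 + c ≤⟨ s≤s (least χ (Bound-⊑ (⊑-inverse {H = H} ⟨ s ⟩) (bound χ′))) ⟩
      1 + d ∎)
      where open ℕ.≤-Reasoning
  forbidden⇐ {suc m} {G} (¬inClass , proper) | c , χ | inj₁ (w , large) =
    critical-neighbourhood (shrink G w dominating (bound χ))
    where
    proper-delete : ∀ u → Class (delete G u)
    proper-delete u = proper m (delete G u) ≤-refl (sub (delete⊑ G u))

    dominating : Dominating G w
    dominating u u≢w with adj G w u in wu
    ... | true  = refl
    -- Deleting a non-neighbour of `w` keeps the degree of `w` and does not raise ν, so the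
    -- violation would survive.
    ... | false = ⊥-elim (violation (Bound-⊑ (delete⊑ G u) (bound χ)) (punchOut u≢w) degree-kept (proper-delete u))
      where
      degree-kept : 2 + c ≤ degree (delete G u) (punchOut u≢w)
      degree-kept = ≤-trans large (≤-reflexive (trans (count-punchIn (adj G w) u)
        (trans (cong (λ b → indicator b + count (adj G w ∘ punchIn u)) wu)
               (cong (λ x → count (adj G x ∘ punchIn u)) (≡-sym (punchIn-punchOut u≢w))))))

    critical-neighbourhood : (∃ λ d → c ≡ suc d × Bound (delete G w) d) → Forbidden G
    critical-neighbourhood (d , refl , b) = forbidden w dominating
      (enough (delete G w) b (≤-trans large (≤-reflexive (degree-dominating G dominating))) deletions)
      where
      -- The equation `e` permits deletions before the order of `H` is known to be positive.
      -- Matching on 3 + d ≤ m settles that and fixes k = m - 3.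
      enough : (H : Graph m) → Bound H d → 3 + d ≤ m →
               (∀ {l} (e : m ≡ suc l) (u : Fin (suc l)) {c} → Bound (delete (subst Graph e H) u) c → m ≤ 3 + c) → Critical H
      enough H b (s≤s (s≤s (s≤s le))) del =
        critical (Bound-≤ le b) λ u b′ → ℕ.+-cancelˡ-≤ 3 _ _ (del refl u b′)

      -- In G - u the vertex `w` has degree m - 1, and the number is at most c + 1. If m > 3 + c,
      -- the violation would survive in this proper subgraph.
      deletions : ∀ {l} (e : m ≡ suc l) (u : Fin (suc l)) {c} → Bound (delete (subst Graph e (delete G w)) u) c → m ≤ 3 + c
      deletions {l} refl u {c} b′ = ℕ.≮⇒≥ λ lt →
        violation (grow (delete G u′) w′ (Bound-⊑ inside b′)) w′
          (≤-trans (ℕ.≤-pred lt) (≤-reflexive (≡-sym (degree-dominating (delete G u′) dominating′)))) (proper-delete u′)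
        where
        u′ : Fin (2 + l)
        u′ = punchIn w u
        u′≢w : u′ ≢ w
        u′≢w = punchInᵢ≢i w u
        w′ : Fin (suc l)
        w′ = punchOut u′≢w
        w′≡ : punchIn u′ w′ ≡ w
        w′≡ = punchIn-punchOut u′≢w
        dominating′ : Dominating (delete G u′) w′
        dominating′ x x≢w′ = trans (cong (λ y → adj G y (punchIn u′ x)) w′≡)
          (dominating _ λ eq → x≢w′ (punchIn-injective u′ _ _ (trans eq (≡-sym w′≡))))
        outside : delete (delete G u′) w′ ⊑ G
        outside = ⊑-trans (delete⊑ (delete G u′) w′) (delete⊑ G u′)
        w∉ : ∀ i → map outside i ≢ w
        w∉ i eq = punchInᵢ≢i w′ i (punchIn-injective u′ _ _ (trans eq (≡-sym w′≡)))
        -- Deleting `u` and `w` in either order leaves the same graph.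
        inside : delete (delete G u′) w′ ⊑ delete (delete G w) u
        inside = ⊑-delete (⊑-delete outside w∉) λ i eq →
          punchInᵢ≢i u′ (punchIn w′ i) (trans (≡-sym (punchIn-punchOut (w∉ i ∘ ≡-sym))) (cong (punchIn w) eq))

  module _ (G : Graph (4 + k)) (v : Fin (4 + k)) (dom : Dominating G v)
           (crit : ∀ u {c} → Bound (delete (delete G v) u) c → k ≤ c) where

    -- `S` lies in G - v - x, which has 2 + k vertices and number at least k. Adding the missing
    -- vertices to `S` yields a bound of at most c + (2 + k - m), hence m ≤ 2 + c.
    avoid-two : ∀ {x} {S : Graph m} {c} (s : S ⊑ G) → x ≢ v → (∀ i → map s i ≢ v) → (∀ i → map s i ≢ x) →
                Bound S c → ¬ (3 + c ≤ m)
    avoid-two {m} {x} {S} {c} s x≢v v∉ x∉ b large = ℕ.<-irrefl refl (begin-strict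
      k + m       ≤⟨ ℕ.+-monoˡ-≤ m (crit (punchOut (x≢v ∘ ≡-sym)) (proj₁ (proj₂ ext))) ⟩
      proj₁ ext + m ≤⟨ proj₂ (proj₂ ext) ⟩
      c + (2 + k) ≡⟨ ℕ.+-assoc c 2 k ⟨
      (c + 2) + k ≡⟨ cong (_+ k) (ℕ.+-comm c 2) ⟩
      (2 + c) + k <⟨ ℕ.+-monoˡ-< k large ⟩
      m + k       ≡⟨ ℕ.+-comm m k ⟩
      k + m       ∎)
      where
      open ℕ.≤-Reasoning
      s′ : S ⊑ delete (delete G v) (punchOut (x≢v ∘ ≡-sym))
      s′ = ⊑-delete (⊑-delete s v∉) λ i eq → x∉ i (punchOut-injective (v∉ i ∘ ≡-sym) (x≢v ∘ ≡-sym) eq)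
      ext : ∃ λ d → Bound (delete (delete G v) (punchOut (x≢v ∘ ≡-sym))) d × d + m ≤ c + (2 + k)
      ext = Bound-extend s′ b

    -- The neighbourhood S of a violating `w` has bound c - 1 and at least 2 + c vertices. For
    -- `avoid-two` it must miss `v` and one more vertex: the image of `w` serves, or, if that is
    -- `v`, a vertex of `G` outside `K`. If S contains `v`, removing `v` lowers order and bound
    -- together.
    proper-degree : ∀ {K : Graph m} {c} (r : K ⊑ G) → m < 4 + k → Bound K c → ∀ w → ¬ (2 + c ≤ degree K w)
    proper-degree {m} {K} {c} r m< b w large = absurd (shrink (cone S) zero (λ { zero ne → contradiction refl ne ; (suc _) _ → refl })
                                                          (Bound-⊑ (cone⊑ nbrs w-adj) b))
      where
      d : ℕ
      d = degree K w
      g : Fin d → Fin m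
      g = proj₁ (enumerate (adj K w))
      w-adj : ∀ i → adj K w (g i) ≡ true
      w-adj = proj₂ (proj₂ (enumerate (adj K w)))
      S : Graph d
      S = induce K g
      nbrs : S ⊑ K
      nbrs = induce⊑ K (proj₁ (proj₂ (enumerate (adj K w))))
      g≢w : ∀ i → g i ≢ w
      g≢w i eq = contradiction (trans (≡-sym (w-adj i)) (trans (cong (adj K w) eq) (irrefl K w))) λ ()
      s : S ⊑ G
      s = ⊑-trans nbrs r
      rw∉ : ∀ i → map s i ≢ map r w
      rw∉ i eq = g≢w i (map-inj r eq)

      with-v : ∀ {e} (S : Graph e) (s : S ⊑ G) → (∀ i → map s i ≢ map r w) → ∀ {c₁} → Bound S c₁ → 3 + c₁ ≤ e →
               ∀ i → map s i ≡ v → ⊥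
      with-v {suc e} S s rw∉ bS large i hit with shrink S i S-dom bS
        where
        S-dom : Dominating S i
        S-dom j j≢i = trans (map-adj s i j) (trans (cong (λ x → adj G x (map s j)) hit)
                            (dom _ λ eq → j≢i (map-inj s (trans eq (≡-sym hit)))))
      ... | c₂ , refl , b₂ = avoid-two (⊑-trans (delete⊑ S i) s) (λ eq → rw∉ i (trans hit (≡-sym eq)))
                               (λ j eq → punchInᵢ≢i i j (map-inj s (trans eq (≡-sym hit)))) (λ j → rw∉ _) b₂ (ℕ.≤-pred large)

      absurd : (∃ λ c₁ → c ≡ suc c₁ × Bound (delete (cone S) zero) c₁) → ⊥
      absurd (c₁ , refl , b₁) with any? (λ i → map s i ≟ v) | map r w ≟ v
      ... | yes (i , hit) | _     = with-v S s rw∉ b₁ large i hit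
      ... | no v∉ | no rw≢v       = avoid-two s rw≢v (λ i eq → v∉ (i , eq)) rw∉ b₁ large
      ... | no v∉ | yes rw≡v      =
        let u , u∉ = missed {f = map r} m<
        in avoid-two s (λ eq → u∉ w (trans rw≡v (≡-sym eq))) (λ i eq → v∉ (i , eq)) (λ i → u∉ _) b₁ large

  forbidden⇒ : {G : Graph n} → Forbidden G → MinForbidden Class G
  forbidden⇒ {G = G} (forbidden v dom (critical b crit)) =
    violation (grow G v b) v (≤-reflexive (≡-sym (degree-dominating G dom))) ,
    λ m H m<n s p K t c χ → case-split {H = H} m<n s K t c χ
    where
    case-split : ∀ {m} {H : Graph m} → m < _ → InducedSub H G → ∀ {p} (K : Graph p) → InducedSub K H → ∀ c → Number K c → Δ K + 1 ≤ c + 2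
    case-split {H = H} m<n s K t c χ with Δ-split K (1 + c)
    ... | inj₂ small = small⇒≤ small
    ... | inj₁ (w , large) = ⊥-elim (proper-degree G v dom crit {K = K} (⊑-trans {H = H} ⟨ t ⟩ ⟨ s ⟩)
            (ℕ.≤-<-trans (⊑-size {H = K} {G = H} ⟨ t ⟩) m<n) (bound χ) w large)

-- Least witnesses

leastWitness : {P : ℕ → Set} → (∀ c → Dec (P c)) → ∀ c → P c → ∃ λ d → P d × (∀ e → P e → d ≤ e)
leastWitness P? zero    p = 0 , p , λ _ _ → z≤n
leastWitness P? (suc c) p with P? 0
... | yes p0 = 0 , p0 , λ _ _ → z≤n
... | no ¬p0 with leastWitness (P? ∘ suc) c p
...   | d , pd , d-least = suc d , pd , λ { zero p0 → contradiction p0 ¬p0 ; (suc e) pe → s≤s (d-least e pe) }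

-- Chromatic number

chromaticNumber : (G : Graph n) → ∃ (IsChromaticNumber G)
chromaticNumber {n} G = leastWitness (colorable? G) n (id , λ { i .i a refl → contradiction (trans (≡-sym (irrefl G i)) a) λ () })

colorable-grow : (G : Graph (suc n)) → ∀ {c} u → Colorable (delete G u) c → Colorable G (suc c)
colorable-grow {n} G {c} u (col , proper) = (λ i → colour i (u ≟ i)) , λ i j → proper′ i j (u ≟ i) (u ≟ j)
  where
  colour : ∀ i → Dec (u ≡ i) → Fin (suc c)
  colour i (yes _)  = zero
  colour i (no u≢i) = suc (col (punchOut u≢i))
  proper′ : ∀ i j d e → adj G i j ≡ true → colour i d ≢ colour j e
  proper′ i .i (yes refl) (yes refl) a eq = contradiction (trans (≡-sym (irrefl G u)) a) λ ()
  proper′ i j (no u≢i) (no u≢j) a eq = proper _ _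
    (trans (cong₂ (adj G) (punchIn-punchOut u≢i) (punchIn-punchOut u≢j)) a) (suc-injective eq)

-- The colour of a dominating vertex occurs nowhere else, so it can be punched out.
colorable-shrink : (G : Graph (suc n)) → ∀ {c} v → Dominating G v → Colorable G c →
                   ∃ λ d → c ≡ suc d × Colorable (delete G v) d
colorable-shrink G {zero}  v dom (col , proper) = contradiction (col v) λ ()
colorable-shrink G {suc c} v dom (col , proper) =
  c , refl , (λ i → punchOut (differs i)) , λ i j a eq → proper _ _ a (punchOut-injective (differs i) (differs j) eq)
  where
  differs : ∀ i → col v ≢ col (punchIn v i)
  differs i = proper v (punchIn v i) (dom _ (punchInᵢ≢i v i))

module χ = Extremal IsChromaticNumber Colorable proj₁ (λ χ col → proj₂ χ _ col) chromaticNumber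
  (λ {_} {G} → colorable-≤ G) (λ s → colorable-mono s) colorable-grow colorable-shrink

-- Clique number

-- Cliques are closed under subsets, so excluding order c + 1 excludes every larger order.
CliqueBound : Graph n → ℕ → Set
CliqueBound G c = ¬ HasClique G (suc c)

vertexClique : Fin n → (G : Graph n) → HasClique G 1
vertexClique v G = (λ _ → v) , (λ { {zero} {zero} _ → refl }) , λ { zero zero ne → contradiction refl ne }

cliqueNumber : (G : Graph n) → ∃ (IsCliqueNumber G)
cliqueNumber {n} G with leastWitness (λ c → ¬? (hasClique? G (suc c))) n (λ (f , inj , _) → <-irrefl refl (injective⇒≤ inj))
... | c , b , c-least = c , attained c c-least , λ s cl → ℕ.≮⇒≥ λ c<s → b (clique-≤ G c<s cl)
  where
  attained : ∀ c → (∀ d → CliqueBound G d → c ≤ d) → HasClique G c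
  attained zero    _ = (λ ()) , (λ { {()} }) , λ ()
  attained (suc c) c-least = decidable-stable (hasClique? G (suc c)) λ b → <-irrefl refl (c-least c b)

clique-avoid : (G : Graph (suc n)) → ∀ u {s} → HasClique G (suc s) → HasClique (delete G u) s
clique-avoid G u {s} (f , inj , f-adj) with any? (λ i → f i ≟ u)
... | yes (i , hit) = (λ j → punchOut (≢u j)) ,
    (λ eq → punchIn-injective i _ _ (inj (punchOut-injective (≢u _) (≢u _) eq))) ,
    λ j j′ ne → trans (cong₂ (adj G) (punchIn-punchOut (≢u j)) (punchIn-punchOut (≢u j′)))
                      (f-adj _ _ (ne ∘ punchIn-injective i j j′))
  where
  ≢u : ∀ j → u ≢ f (punchIn i j)
  ≢u j eq = punchInᵢ≢i i j (inj (trans (≡-sym eq) (≡-sym hit)))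
-- If `u` is outside the clique, its first vertex is dropped instead, to reach the same order.
... | no u∉ = (λ j → punchOut (≢u j)) ,
    (λ eq → suc-injective (inj (punchOut-injective (≢u _) (≢u _) eq))) ,
    λ j j′ ne → trans (cong₂ (adj G) (punchIn-punchOut (≢u j)) (punchIn-punchOut (≢u j′)))
                      (f-adj _ _ (ne ∘ suc-injective))
  where
  ≢u : ∀ j → u ≢ f (suc j)
  ≢u j eq = u∉ (suc j , ≡-sym eq)

clique-cone : (G : Graph (suc n)) → ∀ v {s} → Dominating G v → HasClique (delete G v) s → HasClique G (suc s)
clique-cone G v dom (f , inj , f-adj) =
  v ◂ (punchIn v ∘ f) , inj-◂ (inj ∘ punchIn-injective v _ _) (λ i → punchInᵢ≢i v (f i)) ,
  λ { zero zero ne → contradiction refl ne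
    ; zero (suc j) _ → dom _ (punchInᵢ≢i v (f j))
    ; (suc i) zero _ → trans (sym G _ _) (dom _ (punchInᵢ≢i v (f i)))
    ; (suc i) (suc j) ne → f-adj i j (ne ∘ cong suc) }

cliqueBound-shrink : (G : Graph (suc n)) → ∀ {c} v → Dominating G v → CliqueBound G c →
                     ∃ λ d → c ≡ suc d × CliqueBound (delete G v) d
cliqueBound-shrink G {zero}  v dom b = contradiction (vertexClique v G) b
cliqueBound-shrink G {suc c} v dom b = c , refl , b ∘ clique-cone G v dom

module ω = Extremal IsCliqueNumber CliqueBound
  (λ ω cl → <-irrefl refl (proj₂ ω _ cl))
  (λ {_} {G} ω b → ℕ.≮⇒≥ λ lt → b (clique-≤ G lt (proj₁ ω)))
  cliqueNumber
  (λ {_} {G} c≤d b cl → b (clique-≤ G (s≤s c≤d) cl))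
  (λ s b cl → b (clique-mono s cl))
  (λ G u b cl → b (clique-avoid G u cl))
  cliqueBound-shrink

-- Hajnal's clique lemma

-- Boolean vertex sets make unions and intersections of cliques countable.
IsClique : Graph n → (Fin n → Bool) → Set
IsClique G p = ∀ i j → p i ≡ true → p j ≡ true → i ≢ j → adj G i j ≡ true

clique-count : (G : Graph n) {p : Fin n → Bool} → IsClique G p → HasClique G (count p)
clique-count G {p} p-clique =
  let g , g-inj , g-p = enumerate p in g , g-inj , λ i j ne → p-clique _ _ (g-p i) (g-p j) (ne ∘ g-inj)

image : (Fin m → Fin n) → Fin n → Bool
image f x = does (any? λ i → f i ≟ x)

image-true : (f : Fin m → Fin n) → ∀ i → image f (f i) ≡ true
image-true f i with any? (λ j → f j ≟ f i)
... | yes _    = refl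
... | no none  = contradiction (i , refl) none

image-hit : (f : Fin m → Fin n) → ∀ x → image f x ≡ true → ∃ λ i → f i ≡ x
image-hit f x eq with any? (λ j → f j ≟ x)
... | yes found = found

count-∨∧ : (p q : Fin n → Bool) → count (λ i → p i ∨ q i) + count (λ i → p i ∧ q i) ≡ count p + count q
count-∨∧ {zero}  p q = refl
count-∨∧ {suc n} p q = trans (interchange (indicator (p zero ∨ q zero)) _ _ _)
  (trans (cong₂ _+_ (bits (p zero) (q zero)) (count-∨∧ (p ∘ suc) (q ∘ suc)))
         (interchange (indicator (p zero)) _ _ _))
  where
  open import Algebra.Properties.CommutativeSemigroup ℕ.+-commutativeSemigroup using (interchange)
  bits : ∀ a b → indicator (a ∨ b) + indicator (a ∧ b) ≡ indicator a + indicator b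
  bits false false = refl
  bits false true  = refl
  bits true  false = refl
  bits true  true  = refl

∨-true : ∀ a {b} → a ∨ b ≡ true → a ≡ true ⊎ b ≡ true
∨-true true  _  = inj₁ refl
∨-true false eq = inj₂ eq

∧-true : ∀ a {b} → a ∧ b ≡ true → a ≡ true × b ≡ true
∧-true true eq = refl , eq

module Hajnal (G : Graph n) (s : ℕ) (bounded : ∀ {p} → IsClique G p → count p ≤ s) where

  -- `A` is built as the intersection of the cliques and `U` as their union. Carrying along that `A`
  -- is completely joined to `U` lets the induction form a new clique, A ∪ (U ∩ K₀), to which the
  -- bound `s` applies.
  hajnal : (K : Fin (suc m) → Fin n → Bool) → (∀ i → IsClique G (K i)) → (∀ i → s ≤ count (K i)) →
    Σ (Fin n → Bool) λ A → Σ (Fin n → Bool) λ U →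
      (∀ i x → A x ≡ true → K i x ≡ true) × (∀ x → A x ≡ true → U x ≡ true) ×
      (∀ x y → A x ≡ true → U y ≡ true → x ≢ y → adj G x y ≡ true) × s + s ≤ count A + count U
  hajnal {zero} K cl large =
    K zero , K zero , (λ { zero x a → a }) , (λ x a → a) , cl zero , ℕ.+-mono-≤ (large zero) (large zero)
  hajnal {suc m} K cl large with hajnal (K ∘ suc) (cl ∘ suc) (large ∘ suc)
  ... | A , U , A⊆K , A⊆U , A-U , big = A′ , U′ , A′⊆K , A′⊆U′ , A′-U′ , big′
    where
    K₀ A′ U′ UK C : Fin n → Bool
    K₀ = K zero
    A′ x = A x ∧ K₀ x
    U′ x = U x ∨ K₀ x
    UK x = U x ∧ K₀ x
    C x = A x ∨ UK x
    A′⊆K : ∀ i x → A′ x ≡ true → K i x ≡ true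
    A′⊆K zero    x a = proj₂ (∧-true (A x) a)
    A′⊆K (suc i) x a = A⊆K i x (proj₁ (∧-true (A x) a))
    A′⊆U′ : ∀ x → A′ x ≡ true → U′ x ≡ true
    A′⊆U′ x a rewrite A⊆U x (proj₁ (∧-true (A x) a)) = refl
    A′-U′ : ∀ x y → A′ x ≡ true → U′ y ≡ true → x ≢ y → adj G x y ≡ true
    A′-U′ x y a u with ∧-true (A x) a | ∨-true (U y) u
    ... | a , _ | inj₁ u = A-U x y a u
    ... | _ , k | inj₂ k′ = cl zero x y k k′
    C-clique : IsClique G C
    C-clique x y c d ne with ∨-true (A x) c | ∨-true (A y) d
    ... | inj₁ a | inj₁ b = A-U x y a (A⊆U y b) ne
    ... | inj₁ a | inj₂ b = A-U x y a (proj₁ (∧-true (U y) b)) ne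
    ... | inj₂ a | inj₁ b = trans (sym G x y) (A-U y x b (proj₁ (∧-true (U x) a)) (ne ∘ ≡-sym))
    ... | inj₂ a | inj₂ b = cl zero x y (proj₂ (∧-true (U x) a)) (proj₂ (∧-true (U y) b)) ne
    A∩UK≤ : count (λ x → A x ∧ UK x) ≤ count A′
    A∩UK≤ = count-inj id _ _ λ x t → let a , uk = ∧-true (A x) t in cong₂ _∧_ a (proj₂ (∧-true (U x) uk))
    big′ : s + s ≤ count A′ + count U′
    -- Inclusion-exclusion is applied to `A` with U ∩ K₀ and to `U` with K₀; then |U ∩ K₀| + s
    -- cancels.
    big′ = ℕ.+-cancelˡ-≤ (count UK + s) _ _ (begin
      (count UK + s) + (s + s)                 ≤⟨ ℕ.+-mono-≤ (ℕ.+-monoʳ-≤ (count UK) (large zero)) big ⟩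
      (count UK + count K₀) + (count A + count U) ≡⟨ solve 4 (λ x κ a u → (x :+ κ) :+ (a :+ u) := (a :+ x) :+ (u :+ κ)) refl (count UK) (count K₀) (count A) (count U) ⟩
      (count A + count UK) + (count U + count K₀) ≡⟨ cong₂ _+_ (count-∨∧ A UK) (count-∨∧ U K₀) ⟨
      (count C + count (λ x → A x ∧ UK x)) + (count U′ + count UK) ≤⟨ ℕ.+-monoˡ-≤ _ (ℕ.+-mono-≤ (bounded C-clique) A∩UK≤) ⟩
      (s + count A′) + (count U′ + count UK)   ≡⟨ solve 4 (λ s a u x → (s :+ a) :+ (u :+ x) := (x :+ s) :+ (a :+ u)) refl s (count A′) (count U′) (count UK) ⟩
      (count UK + s) + (count A′ + count U′)   ∎)
      where
      open ℕ.≤-Reasoning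
      open +-*-Solver

count-empty : (p : Fin n → Bool) → (∀ i → p i ≢ true) → count p ≡ 0
count-empty {zero}  p none = refl
count-empty {suc n} p none with p zero in p0
... | true  = contradiction p0 (none zero)
... | false = count-empty (p ∘ suc) (none ∘ suc)

k+k≤3+k⇒k≤3 : ∀ k → k + k ≤ 3 + k → k ≤ 3
k+k≤3+k⇒k≤3 k = ℕ.+-cancelʳ-≤ k k 3

-- One k-clique avoiding each vertex gives a family with empty intersection, so its union, of at
-- most 3 + k vertices, has at least 2k.
few-cliques : (H : Graph (3 + k)) → CliqueBound H k → (∀ u → HasClique (delete H u) k) → k ≤ 3
few-cliques {k} H b avoid =
  let A , U , A⊆K , _ , _ , big = hajnal K K-clique K-large
      A-empty = count-empty A λ x a → misses x (A⊆K x x a)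
  in k+k≤3+k⇒k≤3 k (≤-trans big (≤-trans (≤-reflexive (cong (_+ count U) A-empty)) (count-≤ U)))
  where
  open Hajnal H k (λ {p} cl → ℕ.≮⇒≥ λ k<p → b (clique-≤ H k<p (clique-count H cl)))
  f : Fin (3 + k) → Fin k → Fin (3 + k)
  f u = punchIn u ∘ proj₁ (avoid u)
  K : Fin (3 + k) → Fin (3 + k) → Bool
  K u = image (f u)
  f-inj : ∀ u → Inj (f u)
  f-inj u eq = proj₁ (proj₂ (avoid u)) (punchIn-injective u _ _ eq)
  K-clique : ∀ u → IsClique H (K u)
  K-clique u x y kx ky ne with image-hit (f u) x kx | image-hit (f u) y ky
  ... | i , refl | j , refl = proj₂ (proj₂ (avoid u)) i j λ { refl → ne refl }
  K-large : ∀ u → k ≤ count (K u)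
  K-large u = ≤-trans (≤-reflexive (≡-sym (count-full {k} (λ _ → true) λ _ → refl)))
                      (count-inj (f-inj u) (λ _ → true) (K u) λ i _ → image-true (f u) i)
  misses : ∀ u → K u u ≢ true
  misses u hit = let i , eq = image-hit (f u) u hit in punchInᵢ≢i u _ eq

-- Every colour class of a critical graph has two vertices, since otherwise deleting its only vertex saves a colour.
few-colours : (H : Graph (3 + k)) → Colorable H k → (∀ u {c} → Colorable (delete H u) c → k ≤ c) → k ≤ 3
few-colours {zero} H _ _ = z≤n
few-colours {suc k} H (col , proper) crit = k+k≤3+k⇒k≤3 (suc k)
  (≤-trans (≤-reflexive (trans (cong (suc k +_) (≡-sym (ℕ.+-identityʳ (suc k)))) (ℕ.*-comm 2 (suc k))))
           (injective⇒≤ pairs-inj))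
  where
  other : ∀ u q → ∃ λ i → col (punchIn u i) ≡ q
  other u q = decidable-stable (any? λ i → col (punchIn u i) ≟ q) λ none →
    let q≢ i eq = none (i , ≡-sym eq) in
    <-irrefl refl (crit u ((λ i → punchOut (q≢ i)) , λ i j a eq → proper _ _ a (punchOut-injective (q≢ i) (q≢ j) eq)))
  -- Every colour survives the deletion of any one vertex, so a second vertex of colour `q` is found
  -- after deleting the first. The start at vertex `zero` is arbitrary.
  pair : Fin (suc k) → Fin 2 → Fin (4 + k)
  pair q zero    = punchIn zero (proj₁ (other zero q))
  pair q (suc _) = punchIn (pair q zero) (proj₁ (other (pair q zero) q))
  col-pair : ∀ q b → col (pair q b) ≡ q
  col-pair q zero    = proj₂ (other zero q)
  col-pair q (suc _) = proj₂ (other (pair q zero) q)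
  pair-inj : ∀ q q′ b b′ → pair q b ≡ pair q′ b′ → (q , b) ≡ (q′ , b′)
  pair-inj q q′ b b′ eq with trans (≡-sym (col-pair q b)) (trans (cong col eq) (col-pair q′ b′))
  pair-inj q q′ zero       zero       eq | refl = refl
  pair-inj q q′ zero       (suc _)    eq | refl = contradiction (≡-sym eq) (punchInᵢ≢i _ _)
  pair-inj q q′ (suc _)    zero       eq | refl = contradiction eq (punchInᵢ≢i _ _)
  pair-inj q q′ (suc zero) (suc zero) eq | refl = refl
  rq : Fin (suc k * 2) → Fin (suc k) × Fin 2
  rq = remQuot 2
  pairs : Fin (suc k * 2) → Fin (4 + k)
  pairs x = pair (proj₁ (rq x)) (proj₂ (rq x))
  pairs-inj : Inj pairs
  pairs-inj {x} {y} eq = trans (≡-sym (combine-remQuot {suc k} 2 x))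
    (trans (cong (λ (q , b) → combine q b) (pair-inj (proj₁ (rq x)) (proj₁ (rq y)) (proj₂ (rq x)) (proj₂ (rq y)) eq))
         (combine-remQuot {suc k} 2 y))

-- Classification of the critical graphs for χ

edgeless⊑E4 : (G : Graph 4) → (∀ i j → adj G i j ≢ true) → G ⊑ E4
edgeless⊑E4 G none = ⟨ id , id , (λ i j → ¬-not (none i j)) ⟩

edge⇒clique : (G : Graph n) → ∀ {i j} → adj G i j ≡ true → HasClique G 2
edge⇒clique G {i} {j} a = h , h-inj , h-adj
  where
  i≢j : i ≢ j
  i≢j refl = contradiction (trans (≡-sym (irrefl G i)) a) λ ()
  h : Fin 2 → Fin _
  h zero       = i
  h (suc zero) = j
  h-inj : Inj h
  h-inj {zero}     {zero}     _  = refl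
  h-inj {zero}     {suc zero} eq = contradiction eq i≢j
  h-inj {suc zero} {zero}     eq = contradiction (≡-sym eq) i≢j
  h-inj {suc zero} {suc zero} _  = refl
  h-adj : ∀ x y → x ≢ y → adj G (h x) (h y) ≡ true
  h-adj zero       zero       ne = contradiction refl ne
  h-adj zero       (suc zero) _  = a
  h-adj (suc zero) zero       _  = trans (sym G j i) a
  h-adj (suc zero) (suc zero) ne = contradiction refl ne

¬1-colorable⇒clique : (G : Graph n) → ¬ Colorable G 1 → HasClique G 2
¬1-colorable⇒clique G ¬col = decidable-stable (hasClique? G 2) λ ¬cl →
  ¬col ((λ _ → zero) , λ i j a → contradiction (edge⇒clique G a) ¬cl)

C5-not-bipartite : ¬ Colorable C5 2
C5-not-bipartite = from-no (colorable? C5 2)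

-- No five-vertex deletion is bipartite, so each contains a triangle unless one of them is `C5`.
six-vertices-3-colorable : (H : Graph 6) → Colorable H 3 → (∀ u → ¬ Colorable (delete H u) 2) →
  (∀ u → HasClique (delete H u) 3) ⊎ (SubgraphOf H K6-3e × (InducedSub C5-3 H ⊎ InducedSub C5-4 H))
six-vertices-3-colorable H col crit = split (any? λ u → inducedSub? C5 (delete H u))
  where
  split : Dec (∃ λ u → InducedSub C5 (delete H u)) → _
  split (yes (u , s)) = inj₂ (six-vertices-C5 H (⊑-trans {H = delete H u} ⟨ s ⟩ (delete⊑ H u)) crit col)
  split (no no-C5)    = inj₁ triangle
    where
    triangle : ∀ u → HasClique (delete H u) 3
    triangle u with triangle-or-bipartite-or-C5 (delete H u)
    ... | inj₁ t        = t
    ... | inj₂ (inj₁ b) = contradiction b (crit u)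
    ... | inj₂ (inj₂ s) = contradiction (u , s) no-C5

InducedSub⇒≅ : (X G : Graph n) → InducedSub X G → G ≅ X
InducedSub⇒≅ X G s = ⊑⇒≅ (⊑-inverse {H = X} {G = G} ⟨ s ⟩)

-- Shared by χ and ω: a 3-colouring and the clique bound 3 both exclude a four-clique.
triangles⇒Case3 : (H : Graph 6) → ¬ HasClique H 4 → (∀ u → HasClique (delete H u) 3) → Case3 H
triangles⇒Case3 H ¬K4 triangle =
  split (six-vertices-triangle H (clique⇒⊑ H (clique-mono (delete⊑ H zero) (triangle zero))) triangle)
  where
  split : HasClique H 4 ⊎ SubgraphOf H K6-3e × (InducedSub S3 H ⊎ SubgraphOf K3K3 H) → Case3 H
  split (inj₁ K4)                = contradiction K4 ¬K4
  split (inj₂ (H⊆ , inj₁ s))     = refl , H⊆ , inj₁ (InducedSub⇒≅ S3 H s)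
  split (inj₂ (H⊆ , inj₂ K3K3⊆)) = refl , H⊆ , inj₂ (inj₁ K3K3⊆)

Cases : Graph m → Set
Cases H = Case1 H ⊎ Case2 H ⊎ Case3 H

χ-critical⇒cases : {H : Graph m} → χ.Critical H → Cases H
χ-critical⇒cases (χ.critical {H = H} b crit) = cases _ H b crit (few-colours H b crit)
  where
  five : (H : Graph 5) → Colorable H 2 → HasClique H 3 ⊎ InducedSub C5 H ⊎ (SubgraphOf K2K2K1 H × SubgraphOf H K23) → Case2 H
  five H b (inj₁ triangle)     = contradiction (clique≤colors H triangle b) λ { (s≤s (s≤s ())) }
  five H b (inj₂ (inj₁ C5⊑))   = contradiction (colorable-mono {H = C5} {G = H} ⟨ C5⊑ ⟩ b) C5-not-bipartite
  five H b (inj₂ (inj₂ sides)) = refl , sides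
  six : (H : Graph 6) → Colorable H 3 → (∀ u → HasClique (delete H u) 3) ⊎ (SubgraphOf H K6-3e × (InducedSub C5-3 H ⊎ InducedSub C5-4 H)) → Case3 H
  six H b (inj₁ triangle)      = triangles⇒Case3 H (λ K4 → <-irrefl refl (clique≤colors H K4 b)) triangle
  six H b (inj₂ (H⊆ , inj₁ s)) = refl , H⊆ , inj₂ (inj₂ (inj₁ (InducedSub⇒≅ C5-3 H s)))
  six H b (inj₂ (H⊆ , inj₂ s)) = refl , H⊆ , inj₂ (inj₂ (inj₂ (InducedSub⇒≅ C5-4 H s)))
  one : (x y : Fin 1) → x ≡ y
  one zero zero = refl
  cases : ∀ k (H : Graph (3 + k)) → Colorable H k → (∀ u {c} → Colorable (delete H u) c → k ≤ c) → k ≤ 3 → Cases H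
  cases 0 H (col , _) crit _ = contradiction (col zero) λ ()
  cases 1 H (col , proper) crit _ = inj₁ (⊑⇒≅ (edgeless⊑E4 H λ i j a → proper i j a (one _ _)))
  cases 2 H b crit _ =
    inj₂ (inj₁ (five H b (five-vertices H λ u → ¬1-colorable⇒clique (delete H u) λ col → <-irrefl refl (crit u col))))
  cases 3 H b crit _ = inj₂ (inj₂ (six H b (six-vertices-3-colorable H b λ u col → <-irrefl refl (crit u col))))
  cases (suc (suc (suc (suc k)))) H b crit (s≤s (s≤s (s≤s ())))

-- The listed graphs are critical for χ

delete-⊆ : (X H : Graph (suc n)) ((f , _) : SubgraphOf X H) → ∀ u → SubgraphOf (delete X u) (delete H (f u))
delete-⊆ X H (f , inj , f-adj) u =
  (λ i → punchOut (≢u i)) , (λ {i} {j} eq → punchIn-injective u _ _ (inj (punchOut-injective (≢u i) (≢u j) eq))) ,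
  λ i j a → trans (cong₂ (adj H) (punchIn-punchOut (≢u i)) (punchIn-punchOut (≢u j))) (f-adj _ _ a)
  where
  ≢u : ∀ i → f u ≢ f (punchIn u i)
  ≢u i eq = punchInᵢ≢i u i (≡-sym (inj eq))

-- A spanning embedding is onto, so each deletion of `H` contains a deletion of `X` and inherits its
-- failure to be k-colourable.
critical-⊆ : (X H : Graph (3 + suc k)) → (∀ u → ¬ Colorable (delete X u) k) → SubgraphOf X H →
             Colorable H (suc k) → χ.Critical H
critical-⊆ {k} X H X-crit s@(f , inj , _) b = χ.critical b λ u {c} col → ℕ.≮⇒≥ λ c<k →
  let u′ , fu′≡u = injective⇒surjective inj u
  in X-crit u′ (colorable-⊆ (delete X u′) (delete H (f u′)) (delete-⊆ X H s u′)
       (subst (λ x → Colorable (delete H x) k) (≡-sym fu′≡u) (colorable-≤ (delete H u) (ℕ.≤-pred c<k) col)))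

deletions? : (X : Graph (suc n)) → ∀ c → Dec (∀ u → ¬ Colorable (delete X u) c)
deletions? X c = all? λ u → ¬? (colorable? (delete X u) c)

cases⇒χ-critical : (H : Graph m) → Cases H → χ.Critical H
cases⇒χ-critical H (inj₁ iso) = edgeless H iso (≅-size {H = H} {G = E4} iso)
  where
  edgeless : (H : Graph m) → H ≅ E4 → m ≡ 4 → χ.Critical H
  edgeless H iso refl = critical-⊆ E4 H (from-yes (deletions? E4 0)) (⊑⇒⊆ (⊑-inverse (≅⇒⊑ {H = H} {G = E4} iso)))
    (colorable-mono (≅⇒⊑ {H = H} {G = E4} iso) (from-yes (colorable? E4 1)))
cases⇒χ-critical H (inj₂ (inj₁ (refl , K⊆ , ⊆K))) =
  critical-⊆ K2K2K1 H (from-yes (deletions? K2K2K1 1)) K⊆ (colorable-⊆ H K23 ⊆K (from-yes (colorable? K23 2)))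
cases⇒χ-critical H (inj₂ (inj₂ (refl , H⊆ , which))) = spanning which
  where
  col : Colorable H 3
  col = colorable-⊆ H K6-3e H⊆ (from-yes (colorable? K6-3e 3))
  from-≅ : {X : Graph 6} → (∀ u → ¬ Colorable (delete X u) 2) → H ≅ X → χ.Critical H
  from-≅ {X} X-crit iso = critical-⊆ X H X-crit (⊑⇒⊆ (⊑-inverse (≅⇒⊑ {H = H} {G = X} iso))) col
  spanning : H ≅ S3 ⊎ SubgraphOf K3K3 H ⊎ H ≅ C5-3 ⊎ H ≅ C5-4 → χ.Critical H
  spanning (inj₁ iso)               = from-≅ {S3} (from-yes (deletions? S3 2)) iso
  spanning (inj₂ (inj₁ K⊆))         = critical-⊆ K3K3 H (from-yes (deletions? K3K3 2)) K⊆ col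
  spanning (inj₂ (inj₂ (inj₁ iso))) = from-≅ {C5-3} (from-yes (deletions? C5-3 2)) iso
  spanning (inj₂ (inj₂ (inj₂ iso))) = from-≅ {C5-4} (from-yes (deletions? C5-4 2)) iso

forbidden⇒characterisation : {G : Graph n} → χ.Forbidden G → Characterisation G
forbidden⇒characterisation (χ.forbidden v dom crit) = v , dom , χ-critical⇒cases crit

characterisation⇒forbidden : (G : Graph n) → Characterisation G → χ.Forbidden G
characterisation⇒forbidden {suc m} G (v , dom , cases) = χ.forbidden v dom (cases⇒χ-critical (delete G v) cases)

-- Wheels and cones

-- Both graphs are cones over their deletions, so an embedding of the bases extends to the apexes.
dominating⇒⊑ : (G : Graph (suc m)) (G′ : Graph (suc n)) → ∀ {v v′} → Dominating G v → Dominating G′ v′ →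
               delete G v ⊑ delete G′ v′ → G ⊑ G′
dominating⇒⊑ G G′ {v} {v′} dom dom′ s = ⊑-trans
  (⊑-inverse (cone⊑ (delete⊑ G v) λ i → dom _ (punchInᵢ≢i v i)))
  (cone⊑ (⊑-trans s (delete⊑ G′ v′)) λ i → dom′ _ (punchInᵢ≢i v′ _))

cone-dominating : (X : Graph n) → Dominating (cone X) zero
cone-dominating X zero    ne = contradiction refl ne
cone-dominating X (suc _) _  = refl

W5-dominating : Dominating W5 (fromℕ 5)
W5-dominating = from-yes (all? λ u → ¬? (u ≟ fromℕ 5) →-dec (adj W5 (fromℕ 5) u B.≟ true))

W5-not-Ω : ¬ InΩ 2 W5
W5-not-Ω = ω.violation {G = W5} {3} (from-no (hasClique? W5 4)) (fromℕ 5) (from-yes (5 ℕ.≤? degree W5 (fromℕ 5)))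

W5⊑cone : {X : Graph n} → C5 ⊑ X → W5 ⊑ cone X
W5⊑cone {X = X} = dominating⇒⊑ W5 (cone X) W5-dominating (cone-dominating X)

-- The cone has seven vertices and contains `W5`, which is already outside the class; this
-- contradicts minimality.
not-cone : (X : Graph 6) → C5 ⊑ X → (G : Graph n) → Fω 2 G → ¬ (G ≅ cone X)
not-cone {n} X s G (_ , proper) iso = absurd (≅-size {H = G} {G = cone X} iso) G iso proper
  where
  absurd : n ≡ 7 → (G : Graph n) → G ≅ cone X → ¬ (∀ m (H : Graph m) → m < n → InducedSub H G → InΩ 2 H)
  absurd refl G iso proper =
    W5-not-Ω (proper 6 W5 ≤-refl (sub (⊑-trans (W5⊑cone s) (⊑-inverse (≅⇒⊑ {H = G} {G = cone X} iso)))))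

-- Critical graphs for ω compared with those for χ

critical-cliques : (H : Graph (3 + k)) → (∀ u {c} → CliqueBound (delete H u) c → k ≤ c) → ∀ u → HasClique (delete H u) k
critical-cliques {zero}  H crit u = (λ ()) , (λ { {()} }) , λ ()
critical-cliques {suc k} H crit u = decidable-stable (hasClique? (delete H u) (suc k)) λ b → <-irrefl refl (crit u b)

-- `C5` is the extra case: it satisfies the clique bound 2 but has no 2-colouring.
ω-critical⇒cases : {H : Graph m} → ω.Critical H → H ≅ C5 ⊎ Cases H
ω-critical⇒cases (ω.critical {H = H} b crit) =
  cases _ H b (critical-cliques H crit) (few-cliques H b (critical-cliques H crit))
  where
  five : (H : Graph 5) → CliqueBound H 2 → HasClique H 3 ⊎ InducedSub C5 H ⊎ (SubgraphOf K2K2K1 H × SubgraphOf H K23) → H ≅ C5 ⊎ Cases H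
  five H b (inj₁ triangle)     = contradiction triangle b
  five H b (inj₂ (inj₁ C5⊑))   = inj₁ (InducedSub⇒≅ C5 H C5⊑)
  five H b (inj₂ (inj₂ sides)) = inj₂ (inj₂ (inj₁ (refl , sides)))
  cases : ∀ k (H : Graph (3 + k)) → CliqueBound H k → (∀ u → HasClique (delete H u) k) → k ≤ 3 → H ≅ C5 ⊎ Cases H
  cases 0 H b cl _ = contradiction (vertexClique zero H) b
  cases 1 H b cl _ = inj₂ (inj₁ (⊑⇒≅ (edgeless⊑E4 H λ i j a → b (edge⇒clique H a))))
  cases 2 H b cl _ = five H b (five-vertices H cl)
  cases 3 H b cl _ = inj₂ (inj₂ (inj₂ (triangles⇒Case3 H b cl)))
  cases (suc (suc (suc (suc k)))) H b cl (s≤s (s≤s (s≤s ())))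

-- The upper bound transfers because a clique needs distinct colours. For k ≤ 3 the deletions
-- contain k-cliques, except when k = 3 and some deletion is `C5`, which leads to the two excluded
-- graphs.
χ-critical⇒ω-critical : {H : Graph m} → χ.Critical H → ¬ (H ≅ C5-3) → ¬ (H ≅ C5-4) → ω.Critical H
χ-critical⇒ω-critical (χ.critical {k = k} {H = H} b crit) ≇3 ≇4 =
  ω.critical (λ cl → <-irrefl refl (clique≤colors H cl b)) λ u b′ → ℕ.≮⇒≥ λ c<k →
    b′ (clique-≤ (delete H u) c<k (cliques _ H b crit (few-colours H b crit) ≇3 ≇4 u))
  where
  six : (H : Graph 6) → ¬ (H ≅ C5-3) → ¬ (H ≅ C5-4) →
    (∀ u → HasClique (delete H u) 3) ⊎ (SubgraphOf H K6-3e × (InducedSub C5-3 H ⊎ InducedSub C5-4 H)) →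
    ∀ u → HasClique (delete H u) 3
  six H ≇3 ≇4 (inj₁ triangle)     = triangle
  six H ≇3 ≇4 (inj₂ (_ , inj₁ s)) = contradiction (InducedSub⇒≅ C5-3 H s) ≇3
  six H ≇3 ≇4 (inj₂ (_ , inj₂ s)) = contradiction (InducedSub⇒≅ C5-4 H s) ≇4
  cliques : ∀ k (H : Graph (3 + k)) → Colorable H k → (∀ u {c} → Colorable (delete H u) c → k ≤ c) → k ≤ 3 →
            ¬ (H ≅ C5-3) → ¬ (H ≅ C5-4) → ∀ u → HasClique (delete H u) k
  cliques 0 H b crit _ ≇3 ≇4 u = (λ ()) , (λ { {()} }) , λ ()
  cliques 1 H b crit _ ≇3 ≇4 u = vertexClique zero (delete H u)
  cliques 2 H b crit _ ≇3 ≇4 u = ¬1-colorable⇒clique (delete H u) λ col → <-irrefl refl (crit u col)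
  cliques 3 H b crit _ ≇3 ≇4 = six H ≇3 ≇4 (six-vertices-3-colorable H b λ u col → <-irrefl refl (crit u col))
  cliques (suc (suc (suc (suc k)))) H b crit (s≤s (s≤s (s≤s ())))

deletion-≅⇒≅ : (G : Graph (suc m)) (G′ : Graph (suc n)) → ∀ {v v′} → Dominating G v → Dominating G′ v′ →
               delete G v ≅ delete G′ v′ → G ≅ G′
deletion-≅⇒≅ G G′ {v} {v′} dom dom′ iso with ≅-size {H = delete G v} {G = delete G′ v′} iso
... | refl = ⊑⇒≅ (dominating⇒⊑ G G′ dom dom′ (≅⇒⊑ iso))

-- On six vertices k = 2, so a forbidden graph is 3-colourable, whereas `W5` is not.
W5-not-forbidden : (G : Graph n) → χ.Forbidden G → ¬ (G ≅ W5)
W5-not-forbidden G forb iso = absurd forb iso (≅-size {H = G} {G = W5} iso)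
  where
  absurd : {G : Graph n} → χ.Forbidden G → G ≅ W5 → n ≡ 6 → ⊥
  absurd (χ.forbidden {G = G} v _ (χ.critical b _)) iso refl =
    from-no (colorable? W5 3) (colorable-mono (⊑-inverse (≅⇒⊑ {H = G} {G = W5} iso)) (colorable-grow G v b))

-- The characterisation and the comparison of the two families

characterisation : (G : Graph n) → Fχ 2 G ⇔ Characterisation G
characterisation G = mk⇔ (forbidden⇒characterisation ∘ χ.forbidden⇐) (χ.forbidden⇒ ∘ characterisation⇒forbidden G)

ω⇒χ : (G : Graph n) → Fω 2 G → ¬ (G ≅ W5) → Fχ 2 G
ω⇒χ G Fω ≇W5 = split (ω.forbidden⇐ {G = G} Fω) ≇W5
  where
  conclude : (G : Graph (suc m)) (v : Fin (suc m)) → Dominating G v → ¬ (G ≅ W5) →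
             delete G v ≅ C5 ⊎ Cases (delete G v) → Fχ 2 G
  conclude G v dom ≇W5 (inj₁ iso)   = contradiction (deletion-≅⇒≅ G W5 dom W5-dominating iso) ≇W5
  conclude G v dom ≇W5 (inj₂ cases) = Equivalence.from (characterisation G) (v , dom , cases)
  split : {G : Graph n} → ω.Forbidden G → ¬ (G ≅ W5) → Fχ 2 G
  split (ω.forbidden {G = G} v dom crit) ≇W5 = conclude G v dom ≇W5 (ω-critical⇒cases crit)

χ⇒ω : (G : Graph n) → Fχ 2 G → ¬ (G ≅ cone C5-3) → ¬ (G ≅ cone C5-4) → Fω 2 G
χ⇒ω G Fχ ≇3 ≇4 = ω.forbidden⇒ {G = G} (split (χ.forbidden⇐ Fχ) ≇3 ≇4)
  where
  split : {G : Graph n} → χ.Forbidden G → ¬ (G ≅ cone C5-3) → ¬ (G ≅ cone C5-4) → ω.Forbidden G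
  split (χ.forbidden {G = G} v dom crit) ≇3 ≇4 = ω.forbidden v dom (χ-critical⇒ω-critical crit
    (≇3 ∘ deletion-≅⇒≅ G (cone C5-3) dom (cone-dominating C5-3))
    (≇4 ∘ deletion-≅⇒≅ G (cone C5-4) dom (cone-dominating C5-4)))

theorem7 : (∀ (n : ℕ) (G : Graph n) → Fχ 2 G ⇔ Characterisation G)
    × (∀ (n : ℕ) (G : Graph n) →
    (Fω 2 G × ¬ (G ≅ W5)) ⇔ (Fχ 2 G × ¬ (G ≅ cone C5-3) × ¬ (G ≅ cone C5-4)))
theorem7 = (λ _ → characterisation) , λ _ G → mk⇔
  (λ (Fω , ≇W5) → ω⇒χ G Fω ≇W5
                , not-cone C5-3 ⟨ from-yes (inducedSub? C5 C5-3) ⟩ G Fω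
                , not-cone C5-4 ⟨ from-yes (inducedSub? C5 C5-4) ⟩ G Fω)
  (λ (Fχ , ≇3 , ≇4) → χ⇒ω G Fχ ≇3 ≇4 , W5-not-forbidden G (χ.forbidden⇐ Fχ))
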